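{- For $m,n\in\mathbb{N}$ we have $$S(n+m,m)=\frac{(-1)^n}{(m-1)!}\sum_{k_1+2k_2+\cdots+nk_n=n}(-1)^{k_1+\cdots+k_n}\frac{(k_1+\cdots+k_n+n+m-1)!}{2^{k_1}k_1!\cdot 3^{k_2}k_2!\cdots (n+1)^{k_n}k_n!}$$ and $$s(n+m,m)=\frac{(-1)^n}{(m-1)!}\sum_{k_1+2k_2+\cdots+nk_n=n}(-1)^{k_1+\cdots+k_n}\frac{(k_1+\cdots+k_n+n+m-1)!}{(2!)^{k_1}k_1!\cdot (3!)^{k_2}k_2!\cdots ((n+1)!)^{k_n}k_n!}.$$
   Context: $\mathbb{N}$ is the set of positive integers. For $n\in\mathbb{N}$ and $k\in\{0,1,\ldots,n\}$, the unsigned Stirling number of the first kind $s(n,k)$ and the Stirling number of the second kind $S(n,k)$ are defined by $$x(x-1)\cdots(x-n+1)=\sum_{k=0}^n(-1)^{n-k}s(n,k)x^k,\qquad x^n=\sum_{k=0}^nS(n,k)\,x(x-1)\cdots(x-k+1).$$ The sums run over all $n$-tuples $(k_1,\ldots,k_n)$ of nonnegative integers with $k_1+2k_2+\cdots+nk_n=n$. -}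

module Defs where

open import Data.Fin.Base using (Fin; toℕ) renaming (zero to fzero; suc to fsuc)
open import Data.Fin.Properties using (toℕ-inject₁; toℕ-fromℕ; toℕ≤pred[n])
open import Data.Integer.Base as ℤ using (ℤ; +_; 0ℤ; 1ℤ; -1ℤ)
import Data.Integer.Properties as ℤₚ
open import Data.Integer.Tactic.RingSolver using (solve-∀)
open import Data.List.Base using (List; []; _∷_; foldr; map; filter; upTo; cartesianProductWith)
open import Data.List.Membership.Propositional using (_∈_)
open import Data.List.Membership.Propositional.Properties
  using (∈-filter⁺; ∈-filter⁻; ∈-cartesianProductWith⁺; ∈-upTo⁺)
open import Data.List.Relation.Unary.Any using (here)
import Data.List.Relation.Unary.All as All
open import Data.List.Relation.Unary.AllPairs using ([]; _∷_)
open import Data.List.Relation.Unary.Unique.Propositional using (Unique)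
import Data.List.Relation.Unary.Unique.Propositional.Properties as Unique
open import Data.Nat.Base as ℕ using (ℕ; zero; suc; _+_; _*_; _^_; _!; _≤_; _<_; s≤s; NonZero)
import Data.Nat.Properties as ℕₚ
open import Data.Product.Base using (proj₂)
open import Data.Rational.Base as ℚ using (ℚ; 0ℚ)
open import Data.Vec.Base using (Vec; []; _∷_; lookup)
open import Data.Vec.Properties using (∷-injective)
open import Function.Base using (_∘_)
open import Function.Bundles using (_⇔_; mk⇔)
open import Relation.Binary.PropositionalEquality

import Algebra.Properties.Semiring.Sum as SemiringSum
import Algebra.Properties.Monoid.Sum as MonoidSum

module ℤ∑ = SemiringSum ℤₚ.+-*-semiring
module ℤ∏ = MonoidSum ℤₚ.*-1-monoid
module ℕ∑ = MonoidSum ℕₚ.+-0-monoid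
module ℕ∏ = MonoidSum ℕₚ.*-1-monoid

open ℤ∑ using (sum⁺-syntax)

-- x (x - 1) ⋯ (x - n + 1)
falling : ℤ → ℕ → ℤ
falling x n = ℤ∏.sum {n} λ i → x ℤ.- + toℕ i

-- The polynomial identities are read as identities between the values at
-- every integer x, which determine the coefficients.  Only s n k and S n k
-- with n ≥ 1 and k ≤ n are constrained.

IsStirling₁ : (ℕ → ℕ → ℤ) → Set
IsStirling₁ s = ∀ (n : ℕ) .{{_ : NonZero n}} (x : ℤ) →
  falling x n ≡ ∑[ k ≤ n ] (-1ℤ ℤ.^ (n ℕ.∸ toℕ k) ℤ.* s n (toℕ k) ℤ.* x ℤ.^ toℕ k)

IsStirling₂ : (ℕ → ℕ → ℤ) → Set
IsStirling₂ S = ∀ (n : ℕ) .{{_ : NonZero n}} (x : ℤ) →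
  x ℤ.^ n ≡ ∑[ k ≤ n ] (S n (toℕ k) ℤ.* falling x (toℕ k))

-- A tuple (k₁, …, kₙ) is a vector k with kⱼ = lookup k i, where j = suc (toℕ i).

-- k₁ + 2 k₂ + ⋯ + n kₙ
weight : ∀ {n} → Vec ℕ n → ℕ
weight {n} k = ℕ∑.sum {n} λ i → suc (toℕ i) * lookup k i

boundedTuples : ℕ → (n : ℕ) → List (Vec ℕ n)
boundedTuples b zero    = [] ∷ []
boundedTuples b (suc n) = cartesianProductWith _∷_ (upTo (suc b)) (boundedTuples b n)

-- Entries of a tuple of weight n are at most n, so nothing is lost by
-- searching among the bounded tuples; see ∈-tuples and tuples-unique.
tuples : (n : ℕ) → List (Vec ℕ n)
tuples n = filter (λ k → weight k ℕₚ.≟ n) (boundedTuples n n)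

sumOver : ∀ {A : Set} → List A → (A → ℚ) → ℚ
sumOver ks f = foldr ℚ._+_ 0ℚ (map f ks)

infixl 6 sumOver
syntax sumOver ks (λ k → t) = ∑[ k ∈ ks ] t

-- 2^k₁ k₁! · 3^k₂ k₂! ⋯ (n+1)^kₙ kₙ!
powerDenom : ∀ {n} → Vec ℕ n → ℕ
powerDenom {n} k = ℕ∏.sum {n} λ i → suc (suc (toℕ i)) ^ lookup k i * lookup k i !

-- (2!)^k₁ k₁! · (3!)^k₂ k₂! ⋯ ((n+1)!)^kₙ kₙ!
factorialDenom : ∀ {n} → Vec ℕ n → ℕ
factorialDenom {n} k = ℕ∏.sum {n} λ i → (suc (suc (toℕ i)) !) ^ lookup k i * lookup k i !

private
  ∏≢0 : ∀ {n} (f : Fin n → ℕ) → (∀ i → NonZero (f i)) → NonZero (ℕ∏.sum f)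
  ∏≢0 {zero}  f f≢0 = _
  ∏≢0 {suc n} f f≢0 =
    ℕₚ.m*n≢0 _ _ {{f≢0 fzero}} {{∏≢0 (f ∘ fsuc) (f≢0 ∘ fsuc)}}

  pow*!≢0 : ∀ w j .{{_ : NonZero w}} → NonZero (w ^ j * j !)
  pow*!≢0 w j = ℕₚ.m*n≢0 _ _ {{ℕₚ.m^n≢0 w j}} {{j ℕₚ.!≢0}}

powerDenom≢0 : ∀ {n} (k : Vec ℕ n) → NonZero (powerDenom k)
powerDenom≢0 k = ∏≢0 _ λ i → pow*!≢0 (suc (suc (toℕ i))) (lookup k i)

factorialDenom≢0 : ∀ {n} (k : Vec ℕ n) → NonZero (factorialDenom k)
factorialDenom≢0 k = ∏≢0 _ λ i →
  pow*!≢0 (suc (suc (toℕ i)) !) (lookup k i) {{suc (suc (toℕ i)) ℕₚ.!≢0}}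

private
  term≤sum : ∀ {n} (f : Fin n → ℕ) i → f i ≤ ℕ∑.sum f
  term≤sum f fzero    = ℕₚ.m≤m+n _ _
  term≤sum f (fsuc i) = ℕₚ.≤-trans (term≤sum (f ∘ fsuc) i) (ℕₚ.m≤n+m _ _)

  ∈-boundedTuples : ∀ b {n} (k : Vec ℕ n) → (∀ i → lookup k i ≤ b) → k ∈ boundedTuples b n
  ∈-boundedTuples b []      k≤b = here refl
  ∈-boundedTuples b (j ∷ k) k≤b =
    ∈-cartesianProductWith⁺ _∷_ (∈-upTo⁺ (s≤s (k≤b fzero))) (∈-boundedTuples b k (k≤b ∘ fsuc))

  boundedTuples-unique : ∀ b n → Unique (boundedTuples b n)
  boundedTuples-unique b zero    = All.[] ∷ []
  boundedTuples-unique b (suc n) =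
    Unique.cartesianProductWith⁺ _∷_ ∷-injective (Unique.upTo⁺ (suc b)) (boundedTuples-unique b n)

∈-tuples : ∀ {n} (k : Vec ℕ n) → k ∈ tuples n ⇔ weight k ≡ n
∈-tuples {n} k = mk⇔ (λ k∈ → proj₂ (∈-filter⁻ (λ k → weight k ℕₚ.≟ n) {xs = boundedTuples n n} k∈))
  λ eq → ∈-filter⁺ (λ k → weight k ℕₚ.≟ n)
    (∈-boundedTuples n k λ i → subst (lookup k i ≤_) eq
      (ℕₚ.≤-trans (ℕₚ.m≤n*m _ (suc (toℕ i))) (term≤sum _ i)))
    eq

tuples-unique : ∀ n → Unique (tuples n)
tuples-unique n = Unique.filter⁺ _ (boundedTuples-unique n n)

-- The defining identities are satisfiable.

stirling₁ stirling₂ : ℕ → ℕ → ℤ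
stirling₁ zero    zero    = 1ℤ
stirling₁ zero    (suc k) = 0ℤ
stirling₁ (suc n) zero    = + n ℤ.* stirling₁ n zero
stirling₁ (suc n) (suc k) = + n ℤ.* stirling₁ n (suc k) ℤ.+ stirling₁ n k
stirling₂ zero    zero    = 1ℤ
stirling₂ zero    (suc k) = 0ℤ
stirling₂ (suc n) zero    = 0ℤ
stirling₂ (suc n) (suc k) = + suc k ℤ.* stirling₂ n (suc k) ℤ.+ stirling₂ n k

private
  falling-suc : ∀ x n → falling x (suc n) ≡ falling x n ℤ.* (x ℤ.- + n)
  falling-suc x n = trans (ℤ∏.sum-init-last {n} (λ i → x ℤ.- + toℕ i))
    (cong₂ ℤ._*_ (ℤ∏.sum-cong-≗ {n} λ i → cong (λ j → x ℤ.- + j) (toℕ-inject₁ i))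
                 (cong (λ j → x ℤ.- + j) (toℕ-fromℕ n)))

  -- Σ_{k < n} f k
  Σ< : ℕ → (ℕ → ℤ) → ℤ
  Σ< n f = ℤ∑.sum {n} (f ∘ toℕ)

  Σ<-last : ∀ n f → Σ< (suc n) f ≡ Σ< n f ℤ.+ f n
  Σ<-last n f = trans (ℤ∑.sum-init-last {n} (f ∘ toℕ))
    (cong₂ ℤ._+_ (ℤ∑.sum-cong-≗ {n} λ i → cong f (toℕ-inject₁ i)) (cong f (toℕ-fromℕ n)))

  -- A recurrence c′ₖ₊₁ = aₖ₊₁ + bₖ, c′₀ = a₀ regroups a sum, provided aₙ₊₁ = 0.
  regroup : ∀ n (a b c : ℕ → ℤ) → c 0 ≡ a 0 → (∀ k → c (suc k) ≡ a (suc k) ℤ.+ b k) →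
            a (suc n) ≡ 0ℤ →
            Σ< (suc (suc n)) c ≡ Σ< (suc n) (λ k → a k ℤ.+ b k)
  regroup n a b c c0 cs top = begin
    c 0 ℤ.+ Σ< (suc n) (c ∘ suc)
      ≡⟨ cong₂ ℤ._+_ c0 (trans (ℤ∑.sum-cong-≗ {suc n} (cs ∘ toℕ))
           (ℤ∑.∑-distrib-+ {suc n} (a ∘ suc ∘ toℕ) (b ∘ toℕ))) ⟩
    a 0 ℤ.+ (Σ< (suc n) (a ∘ suc) ℤ.+ Σ< (suc n) b)
      ≡⟨ sym (ℤₚ.+-assoc (a 0) _ _) ⟩
    Σ< (suc (suc n)) a ℤ.+ Σ< (suc n) b
      ≡⟨ cong (ℤ._+ Σ< (suc n) b) (trans (Σ<-last (suc n) a)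
           (trans (cong (λ z → Σ< (suc n) a ℤ.+ z) top) (ℤₚ.+-identityʳ (Σ< (suc n) a)))) ⟩
    Σ< (suc n) a ℤ.+ Σ< (suc n) b
      ≡⟨ sym (ℤ∑.∑-distrib-+ {suc n} (a ∘ toℕ) (b ∘ toℕ)) ⟩
    Σ< (suc n) (λ k → a k ℤ.+ b k) ∎
    where open ≡-Reasoning

  stirling₁-zero : ∀ n k → n < k → stirling₁ n k ≡ 0ℤ
  stirling₁-zero zero    (suc k) _         = refl
  stirling₁-zero (suc n) (suc k) (s≤s n<k)
    rewrite stirling₁-zero n (suc k) (ℕₚ.m<n⇒m<1+n n<k) | stirling₁-zero n k n<k
          | ℤₚ.*-zeroʳ (+ n) = refl

  stirling₂-zero : ∀ n k → n < k → stirling₂ n k ≡ 0ℤ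
  stirling₂-zero zero    (suc k) _         = refl
  stirling₂-zero (suc n) (suc k) (s≤s n<k)
    rewrite stirling₂-zero n (suc k) (ℕₚ.m<n⇒m<1+n n<k) | stirling₂-zero n k n<k
          | ℤₚ.*-zeroʳ (+ suc k) = refl

  falling-expand : ∀ n x →
    falling x n ≡ Σ< (suc n) λ k → -1ℤ ℤ.^ (n ℕ.∸ k) ℤ.* stirling₁ n k ℤ.* x ℤ.^ k
  falling-expand zero    x = refl
  falling-expand (suc n) x = begin
    falling x (suc n)                                  ≡⟨ falling-suc x n ⟩
    falling x n ℤ.* (x ℤ.- + n)                        ≡⟨ cong (ℤ._* (x ℤ.- + n)) (falling-expand n x) ⟩
    Σ< (suc n) t ℤ.* (x ℤ.- + n)                       ≡⟨ ℤ∑.*-distribʳ-sum {suc n} (x ℤ.- + n) (t ∘ toℕ) ⟩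
    Σ< (suc n) (λ k → t k ℤ.* (x ℤ.- + n))             ≡⟨ ℤ∑.sum-cong-≗ {suc n} (λ i → split (toℕ i) (toℕ≤pred[n] i)) ⟩
    Σ< (suc n) (λ k → a k ℤ.+ b k)                     ≡⟨ sym (regroup n a b c refl step top) ⟩
    Σ< (suc (suc n)) c                                 ∎
    where
    open ≡-Reasoning
    t a b c : ℕ → ℤ
    t k = -1ℤ ℤ.^ (n ℕ.∸ k) ℤ.* stirling₁ n k ℤ.* x ℤ.^ k
    a k = -1ℤ ℤ.^ (suc n ℕ.∸ k) ℤ.* (+ n ℤ.* stirling₁ n k) ℤ.* x ℤ.^ k
    b k = -1ℤ ℤ.^ (n ℕ.∸ k) ℤ.* stirling₁ n k ℤ.* (x ℤ.* x ℤ.^ k)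
    c k = -1ℤ ℤ.^ (suc n ℕ.∸ k) ℤ.* stirling₁ (suc n) k ℤ.* x ℤ.^ k

    split-ring : ∀ e u p x m →
      e ℤ.* u ℤ.* p ℤ.* (x ℤ.- m) ≡ -1ℤ ℤ.* e ℤ.* (m ℤ.* u) ℤ.* p ℤ.+ e ℤ.* u ℤ.* (x ℤ.* p)
    split-ring = solve-∀

    split : ∀ k → k ≤ n → t k ℤ.* (x ℤ.- + n) ≡ a k ℤ.+ b k
    split k k≤n rewrite ℕₚ.+-∸-assoc 1 k≤n =
      split-ring (-1ℤ ℤ.^ (n ℕ.∸ k)) (stirling₁ n k) (x ℤ.^ k) x (+ n)

    step-ring : ∀ e u v q → e ℤ.* (u ℤ.+ v) ℤ.* q ≡ e ℤ.* u ℤ.* q ℤ.+ e ℤ.* v ℤ.* q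
    step-ring = solve-∀

    step : ∀ k → c (suc k) ≡ a (suc k) ℤ.+ b k
    step k = step-ring (-1ℤ ℤ.^ (n ℕ.∸ k)) (+ n ℤ.* stirling₁ n (suc k)) (stirling₁ n k) (x ℤ.^ suc k)

    zero-ring : ∀ e m p → e ℤ.* (m ℤ.* 0ℤ) ℤ.* p ≡ 0ℤ
    zero-ring = solve-∀

    top : a (suc n) ≡ 0ℤ
    top rewrite stirling₁-zero n (suc n) ℕₚ.≤-refl =
      zero-ring (-1ℤ ℤ.^ (n ℕ.∸ n)) (+ n) (x ℤ.^ suc n)

  power-expand : ∀ n x → x ℤ.^ n ≡ Σ< (suc n) λ k → stirling₂ n k ℤ.* falling x k
  power-expand zero    x = refl
  power-expand (suc n) x = begin
    x ℤ.* x ℤ.^ n                                      ≡⟨ cong (x ℤ.*_) (power-expand n x) ⟩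
    x ℤ.* Σ< (suc n) t                                 ≡⟨ ℤ∑.*-distribˡ-sum {suc n} x (t ∘ toℕ) ⟩
    Σ< (suc n) (λ k → x ℤ.* t k)                       ≡⟨ ℤ∑.sum-cong-≗ {suc n} (split ∘ toℕ) ⟩
    Σ< (suc n) (λ k → a k ℤ.+ b k)                     ≡⟨ sym (regroup n a b c refl step top) ⟩
    Σ< (suc (suc n)) c                                 ∎
    where
    open ≡-Reasoning
    t a b c : ℕ → ℤ
    t k = stirling₂ n k ℤ.* falling x k
    a k = + k ℤ.* stirling₂ n k ℤ.* falling x k
    b k = stirling₂ n k ℤ.* falling x (suc k)
    c k = stirling₂ (suc n) k ℤ.* falling x k

    split-ring : ∀ x u f m → x ℤ.* (u ℤ.* f) ≡ m ℤ.* u ℤ.* f ℤ.+ u ℤ.* (f ℤ.* (x ℤ.- m))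
    split-ring = solve-∀

    split : ∀ k → x ℤ.* t k ≡ a k ℤ.+ b k
    split k = trans (split-ring x (stirling₂ n k) (falling x k) (+ k))
      (cong (λ f → a k ℤ.+ stirling₂ n k ℤ.* f) (sym (falling-suc x k)))

    step : ∀ k → c (suc k) ≡ a (suc k) ℤ.+ b k
    step k = ℤₚ.*-distribʳ-+ (falling x (suc k)) (+ suc k ℤ.* stirling₂ n (suc k)) (stirling₂ n k)

    zero-ring : ∀ m f → m ℤ.* 0ℤ ℤ.* f ≡ 0ℤ
    zero-ring = solve-∀

    top : a (suc n) ≡ 0ℤ
    top rewrite stirling₂-zero n (suc n) ℕₚ.≤-refl = zero-ring (+ suc n) (falling x (suc n))

stirling₁-isStirling₁ : IsStirling₁ stirling₁
stirling₁-isStirling₁ n x = falling-expand n x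

stirling₂-isStirling₂ : IsStirling₂ stirling₂
stirling₂-isStirling₂ n x = power-expand n x

{-# OPTIONS --safe #-}

-- Fix d₁, d₂, … (dⱼ = j + 1 for S, dⱼ = (j + 1)! for s), put w₀ = 1, wⱼ = 1/dⱼ, and let
-- T(n, M) = Σ (-1)^(k₁+⋯+kₙ) (k₁ + ⋯ + kₙ + M)! ∏ wⱼ^kⱼ / kⱼ!, over the tuples of weight n.
-- Lowering one coordinate turns kⱼ wⱼ^kⱼ / kⱼ! into wⱼ wⱼ^(kⱼ-1) / (kⱼ-1)!, so inserting the
-- factor k₁ + ⋯ + kₙ or k₁ + 2 k₂ + ⋯ + n kₙ = n in the sum gives
--   Σⱼ wⱼ T(n-j, M+1) = (M + 1) T(n, M),   Σⱼ (j + 1) wⱼ T(n-j, M+1) = (M + 1 - n) T(n, M).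
-- For S one has (j + 1) wⱼ = 1, and for s one has (j + 1) wⱼ = wⱼ₋₁, so subtracting from the
-- second relation its predecessor, respectively the first relation at n - 1, leaves three terms:
-- T(n+1, n+1+m) = m T(n+1, n+m) - c T(n, n+m) with c = m + 1, respectively c = n + m + 1.
-- Up to the factor (-1)^n m! this is the recurrence of the Stirling numbers at (n+m+1, m+1).

module Submission where

open import Defs
open import Algebra.Bundles using (CommutativeRing)
import Algebra.Properties.CommutativeMonoid.Sum as CommutativeMonoidSum
import Algebra.Properties.Semiring.Sum as SemiringSum
open import Data.Fin.Base using (Fin; toℕ) renaming (zero to fzero; suc to fsuc)
open import Data.Fin.Properties using (toℕ-inject₁; toℕ-fromℕ)
open import Data.Integer.Base as ℤ using (ℤ; +_; -1ℤ; 0ℤ; 1ℤ)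
import Data.Integer.Properties as ℤₚ
open import Data.Integer.Tactic.RingSolver using () renaming (solve-∀ to solveℤ)
open import Data.List.Base using (List; []; _∷_; _++_; map; filter; applyUpTo; upTo; cartesianProductWith)
open import Data.List.Properties using (filter-accept; filter-reject)
open import Data.Nat.Base as ℕ using (ℕ; zero; suc; _+_; _∸_; _^_; _!; _≤_; _<_; s≤s; NonZero)
import Data.Nat.Properties as ℕₚ
open import Data.Nat.Properties using (_!≢0)
open import Data.Nat.Tactic.RingSolver using () renaming (solve-∀ to solveℕ)
open import Data.Product.Base using (_×_; _,_)
open import Data.Rational.Base as ℚ using (ℚ; _/_; _*_; 0ℚ; 1ℚ; toℚᵘ)
import Data.Rational.Properties as ℚₚ
import Data.Rational.Unnormalised.Base as ℚᵘ
import Data.Rational.Unnormalised.Properties as ℚᵘₚ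
open import Data.Sum.Base using (inj₁; inj₂)
open import Data.Vec.Base using (Vec; []; _∷_; lookup; sum; _[_]%=_)
open import Function.Base using (_∘_; id)
open import Relation.Binary.PropositionalEquality
open import Relation.Nullary.Decidable using (Dec; yes; no; dec⇒maybe)
open import Relation.Nullary.Negation using (contradiction)
open import Tactic.RingSolver using (solve-∀)
import Tactic.RingSolver.Core.AlmostCommutativeRing as ACR

module ℕ∑′ = CommutativeMonoidSum ℕₚ.+-0-commutativeMonoid
module ℚ∑ = SemiringSum (CommutativeRing.semiring ℚₚ.+-*-commutativeRing)
open ℚ∑ using (sum-syntax)

-- Rational arithmetic: embedded integers and reciprocals.

ring : ACR.AlmostCommutativeRing _ _
ring = ACR.fromCommutativeRing ℚₚ.+-*-commutativeRing (λ x → dec⇒maybe (0ℚ ℚₚ.≟ x))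

toℚᵘ-/ : ∀ i d .{{_ : NonZero d}} → toℚᵘ (i / d) ℚᵘ.≃ (i ℚᵘ./ d)
toℚᵘ-/ i (suc d) = ℚₚ.toℚᵘ-fromℚᵘ (ℚᵘ.mkℚᵘ i d)

/-*-/ : ∀ i j c d .{{_ : NonZero c}} .{{_ : NonZero d}} →
  (i / c) * (j / d) ≡ ((i ℤ.* j) / (c ℕ.* d)) {{ℕₚ.m*n≢0 c d}}
/-*-/ i j c@(suc _) d@(suc _) = ℚₚ.toℚᵘ-injective (begin
  toℚᵘ ((i / c) * (j / d))                ≈⟨ ℚₚ.toℚᵘ-homo-* (i / c) (j / d) ⟩
  toℚᵘ (i / c) ℚᵘ.* toℚᵘ (j / d)          ≈⟨ ℚᵘₚ.*-cong (toℚᵘ-/ i c) (toℚᵘ-/ j d) ⟩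
  (i ℤ.* j) ℚᵘ./ (c ℕ.* d)                ≈⟨ ℚᵘₚ.≃-sym (toℚᵘ-/ (i ℤ.* j) (c ℕ.* d)) ⟩
  toℚᵘ ((i ℤ.* j) / (c ℕ.* d))            ∎)
  where open ℚᵘₚ.≃-Reasoning

fromℤ : ℤ → ℚ
fromℤ i = i / 1

fromℤ-* : ∀ i j → fromℤ (i ℤ.* j) ≡ fromℤ i * fromℤ j
fromℤ-* i j = sym (/-*-/ i j 1 1)

fromℤ-+ : ∀ i j → fromℤ (i ℤ.+ j) ≡ fromℤ i ℚ.+ fromℤ j
fromℤ-+ i j = ℚₚ.toℚᵘ-injective (begin
  toℚᵘ (fromℤ (i ℤ.+ j))                  ≈⟨ toℚᵘ-/ (i ℤ.+ j) 1 ⟩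
  (i ℤ.+ j) ℚᵘ./ 1                        ≈⟨ ℚᵘ.*≡* (ringℤ i j) ⟩
  (i ℚᵘ./ 1) ℚᵘ.+ (j ℚᵘ./ 1)              ≈⟨ ℚᵘₚ.≃-sym (ℚᵘₚ.+-cong (toℚᵘ-/ i 1) (toℚᵘ-/ j 1)) ⟩
  toℚᵘ (fromℤ i) ℚᵘ.+ toℚᵘ (fromℤ j)      ≈⟨ ℚᵘₚ.≃-sym (ℚₚ.toℚᵘ-homo-+ (fromℤ i) (fromℤ j)) ⟩
  toℚᵘ (fromℤ i ℚ.+ fromℤ j)              ∎)
  where
  open ℚᵘₚ.≃-Reasoning
  ringℤ : ∀ i j → (i ℤ.+ j) ℤ.* 1ℤ ≡ (i ℤ.* 1ℤ ℤ.+ j ℤ.* 1ℤ) ℤ.* 1ℤ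
  ringℤ = solveℤ

fromℕ : ℕ → ℚ
fromℕ n = fromℤ (+ n)

fromℕ-+ : ∀ m n → fromℕ (m + n) ≡ fromℕ m ℚ.+ fromℕ n
fromℕ-+ m n = trans (cong fromℤ (ℤₚ.pos-+ m n)) (fromℤ-+ (+ m) (+ n))

fromℕ-* : ∀ m n → fromℕ (m ℕ.* n) ≡ fromℕ m * fromℕ n
fromℕ-* m n = trans (cong fromℤ (ℤₚ.pos-* m n)) (fromℤ-* (+ m) (+ n))

-- recip 0 = 0 makes recip-* unconditional.
recip : ℕ → ℚ
recip zero    = 0ℚ
recip (suc n) = 1ℤ / suc n

recip-* : ∀ m n → recip (m ℕ.* n) ≡ recip m * recip n
recip-* zero    n       = sym (ℚₚ.*-zeroˡ (recip n))
recip-* (suc m) zero    rewrite ℕₚ.*-zeroʳ m = sym (ℚₚ.*-zeroʳ (recip (suc m)))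
recip-* (suc m) (suc n) = sym (/-*-/ 1ℤ 1ℤ (suc m) (suc n))

n*recip[n] : ∀ n .{{_ : NonZero n}} → fromℕ n * recip n ≡ 1ℚ
n*recip[n] (suc n) = trans (/-*-/ (+ suc n) 1ℤ 1 (suc n))
  (ℚₚ.fromℚᵘ-cong {ℚᵘ.mkℚᵘ (+ suc n ℤ.* 1ℤ) (n + 0)} {ℚᵘ.mkℚᵘ 1ℤ 0} (ℚᵘ.*≡* (ringℤ (+ suc n))))
  where
  ringℤ : ∀ i → i ℤ.* 1ℤ ℤ.* 1ℤ ≡ 1ℤ ℤ.* (1ℤ ℤ.* i)
  ringℤ = solveℤ

/-recip : ∀ i d .{{_ : NonZero d}} → i / d ≡ fromℤ i * recip d
/-recip i (suc d) = sym (trans (/-*-/ i 1ℤ 1 (suc d))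
  (ℚₚ./-cong (ℤₚ.*-identityʳ i) (ℕₚ.*-identityˡ (suc d))))


interchange : ∀ a b c d → (a ℚ.+ b) ℚ.+ (c ℚ.+ d) ≡ (a ℚ.+ c) ℚ.+ (b ℚ.+ d)
interchange = solve-∀ ring

annihilate : ∀ a b → 0ℚ * a * b ≡ 0ℚ
annihilate = solve-∀ ring

neg : ∀ a → ℚ.- 1ℚ * a ≡ ℚ.- a
neg = solve-∀ ring

minus : ∀ a b → a ℚ.+ b ℚ.- a ≡ b
minus = solve-∀ ring

-- Finite rational sums over lists and ranges.

module _ {A : Set} where

  sumOver-cong : ∀ (ks : List A) {f g : A → ℚ} → (∀ k → f k ≡ g k) → sumOver ks f ≡ sumOver ks g
  sumOver-cong []       f≗g = refl
  sumOver-cong (k ∷ ks) f≗g = cong₂ ℚ._+_ (f≗g k) (sumOver-cong ks f≗g)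

  sumOver-0 : ∀ (ks : List A) {f} → (∀ k → f k ≡ 0ℚ) → sumOver ks f ≡ 0ℚ
  sumOver-0 []       f≗0 = refl
  sumOver-0 (k ∷ ks) f≗0 = cong₂ ℚ._+_ (f≗0 k) (sumOver-0 ks f≗0)

  sumOver-* : ∀ (ks : List A) c f → sumOver ks (λ k → c * f k) ≡ c * sumOver ks f
  sumOver-* []       c f = sym (ℚₚ.*-zeroʳ c)
  sumOver-* (k ∷ ks) c f = trans (cong (c * f k ℚ.+_) (sumOver-* ks c f)) (sym (ℚₚ.*-distribˡ-+ c (f k) _))

  sumOver-+ : ∀ (ks : List A) f g → sumOver ks (λ k → f k ℚ.+ g k) ≡ sumOver ks f ℚ.+ sumOver ks g
  sumOver-+ []       f g = refl
  sumOver-+ (k ∷ ks) f g = trans (cong (f k ℚ.+ g k ℚ.+_) (sumOver-+ ks f g)) (interchange (f k) (g k) _ _)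

  sumOver-∑ : ∀ (ks : List A) {n} (f : Fin n → A → ℚ) →
    sumOver ks (λ k → ∑[ i < n ] f i k) ≡ ∑[ i < n ] sumOver ks (f i)
  sumOver-∑ ks {zero}  f = sumOver-0 ks {λ _ → 0ℚ} λ _ → refl
  sumOver-∑ ks {suc n} f = trans (sumOver-+ ks (f fzero) _) (cong (sumOver ks (f fzero) ℚ.+_) (sumOver-∑ ks (f ∘ fsuc)))

  sumOver-++ : ∀ (ks ls : List A) f → sumOver (ks ++ ls) f ≡ sumOver ks f ℚ.+ sumOver ls f
  sumOver-++ []       ls f = sym (ℚₚ.+-identityˡ _)
  sumOver-++ (k ∷ ks) ls f = trans (cong (f k ℚ.+_) (sumOver-++ ks ls f)) (sym (ℚₚ.+-assoc (f k) _ _))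

sumOver-map : ∀ {A B : Set} (ks : List A) (g : A → B) (f : B → ℚ) → sumOver (map g ks) f ≡ sumOver ks (f ∘ g)
sumOver-map []       g f = refl
sumOver-map (k ∷ ks) g f = cong (f (g k) ℚ.+_) (sumOver-map ks g f)

sumOver-cartesian : ∀ {A B C : Set} (g : A → B → C) ks ls f →
  sumOver (cartesianProductWith g ks ls) f ≡ sumOver ks (λ k → sumOver ls (f ∘ g k))
sumOver-cartesian g []       ls f = refl
sumOver-cartesian g (k ∷ ks) ls f = trans (sumOver-++ (map (g k) ls) _ f)
  (cong₂ ℚ._+_ (sumOver-map ls (g k) f) (sumOver-cartesian g ks ls f))

sumOver-applyUpTo : ∀ (g : ℕ → ℕ) n (f : ℕ → ℚ) → sumOver (applyUpTo g n) f ≡ ∑[ i < n ] f (g (toℕ i))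
sumOver-applyUpTo g zero    f = refl
sumOver-applyUpTo g (suc n) f = cong (f (g 0) ℚ.+_) (sumOver-applyUpTo (g ∘ suc) n f)

∑-last : ∀ n (f : ℕ → ℚ) → ∑[ i < suc n ] f (toℕ i) ≡ ∑[ i < n ] f (toℕ i) ℚ.+ f n
∑-last n f = trans (ℚ∑.sum-init-last {n} (f ∘ toℕ))
  (cong₂ ℚ._+_ (ℚ∑.sum-cong-≗ {n} (cong f ∘ toℕ-inject₁)) (cong f (toℕ-fromℕ n)))

-- Reindexing by j ↦ j + 1 with both ends padded by zero terms, so that the range stays the same.
-- This allows one coordinate of a tuple to be lowered without changing the box of bounded tuples.
sumOver-upTo-shift : ∀ n (f g : ℕ → ℚ) → f 0 ≡ 0ℚ → (∀ j → f (suc j) ≡ g j) → g n ≡ 0ℚ →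
  sumOver (upTo (suc n)) f ≡ sumOver (upTo (suc n)) g
sumOver-upTo-shift n f g f0 fs gn = begin
  sumOver (upTo (suc n)) f                ≡⟨ sumOver-applyUpTo id (suc n) f ⟩
  f 0 ℚ.+ ∑[ i < n ] f (suc (toℕ i))      ≡⟨ cong₂ ℚ._+_ f0 (ℚ∑.sum-cong-≗ {n} (fs ∘ toℕ)) ⟩
  0ℚ ℚ.+ ∑g                               ≡⟨ ℚₚ.+-comm 0ℚ ∑g ⟩
  ∑g ℚ.+ 0ℚ                               ≡⟨ cong (∑g ℚ.+_) gn ⟨
  ∑g ℚ.+ g n                              ≡⟨ ∑-last n g ⟨
  ∑[ i < suc n ] g (toℕ i)                ≡⟨ sumOver-applyUpTo id (suc n) g ⟨
  sumOver (upTo (suc n)) g                ∎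
  where
  open ≡-Reasoning
  ∑g : ℚ
  ∑g = ∑[ i < n ] g (toℕ i)

-- The Kronecker delta as a replacement for the weight condition.

δ : ℕ → ℕ → ℚ
δ zero    zero    = 1ℚ
δ zero    (suc _) = 0ℚ
δ (suc _) zero    = 0ℚ
δ (suc m) (suc n) = δ m n

δ-refl : ∀ n → δ n n ≡ 1ℚ
δ-refl zero    = refl
δ-refl (suc n) = δ-refl n

δ-≢ : ∀ {m n} → m ≢ n → δ m n ≡ 0ℚ
δ-≢ {zero}  {zero}  m≢n = contradiction refl m≢n
δ-≢ {zero}  {suc n} m≢n = refl
δ-≢ {suc m} {zero}  m≢n = refl
δ-≢ {suc m} {suc n} m≢n = δ-≢ (m≢n ∘ cong suc)

δ-subst : ∀ (f : ℕ → ℚ) m n → f m * δ m n ≡ f n * δ m n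
δ-subst f m n with m ℕₚ.≟ n
... | yes refl = refl
... | no m≢n = trans (vanish (f m)) (sym (vanish (f n)))
  where
  vanish : ∀ x → x * δ m n ≡ 0ℚ
  vanish x = trans (cong (x *_) (δ-≢ m≢n)) (ℚₚ.*-zeroʳ x)

-- The condition on the weight becomes a factor of the summand, so that sums for different weights
-- run over one and the same list.
sumOver-filter : ∀ {A : Set} (g : A → ℕ) n ks f →
  sumOver (filter (λ k → g k ℕₚ.≟ n) ks) f ≡ sumOver ks (λ k → δ (g k) n * f k)
sumOver-filter g n []       f = refl
sumOver-filter {A} g n (k ∷ ks) f = by-cases (g k ℕₚ.≟ n)
  where
  P? : ∀ k → Dec (g k ≡ n)
  P? k = g k ℕₚ.≟ n
  rest : ℚ
  rest = sumOver ks (λ k → δ (g k) n * f k)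
  kept : g k ≡ n → f k ≡ δ (g k) n * f k
  kept gk≡n = sym (trans (cong (_* f k) (trans (cong (λ m → δ m n) gk≡n) (δ-refl n))) (ℚₚ.*-identityˡ (f k)))
  dropped : g k ≢ n → 0ℚ ≡ δ (g k) n * f k
  dropped gk≢n = sym (trans (cong (_* f k) (δ-≢ gk≢n)) (ℚₚ.*-zeroˡ (f k)))
  by-cases : Dec (g k ≡ n) → sumOver (filter P? (k ∷ ks)) f ≡ δ (g k) n * f k ℚ.+ rest
  by-cases (yes gk≡n) = trans (cong (λ l → sumOver l f) (filter-accept P? {xs = ks} gk≡n))
    (cong₂ ℚ._+_ (kept gk≡n) (sumOver-filter g n ks f))
  by-cases (no gk≢n) = trans (cong (λ l → sumOver l f) (filter-reject P? {xs = ks} gk≢n))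
    (trans (sumOver-filter g n ks f) (trans (sym (ℚₚ.+-identityˡ rest)) (cong (ℚ._+ rest) (dropped gk≢n))))

-- Lowering one coordinate of a tuple.

denom : ∀ {L} → (Fin L → ℕ) → Vec ℕ L → ℕ
denom {L} d k = ℕ∏.sum {L} λ i → d i ^ lookup k i ℕ.* lookup k i !

-- The factor j + 1 cancels against (j + 1)!, and one power of `d` splits off. `D` stands for the
-- denominator of the remaining coordinates.
coefficient-step : ∀ d j x D →
  fromℕ (suc j) * (x * recip (d ^ suc j ℕ.* suc j ! ℕ.* D)) ≡ recip d * (x * recip (d ^ j ℕ.* j ! ℕ.* D))
coefficient-step d j x D = begin
  fromℕ (suc j) * (x * recip (d ℕ.* d ^ j ℕ.* (suc j ℕ.* j !) ℕ.* D))
    ≡⟨ cong (λ r → fromℕ (suc j) * (x * r)) expand ⟩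
  fromℕ (suc j) * (x * (recip d * recip (d ^ j) * (recip (suc j) * recip (j !)) * recip D))
    ≡⟨ regroup (fromℕ (suc j)) x (recip d) (recip (d ^ j)) (recip (suc j)) (recip (j !)) (recip D) ⟩
  fromℕ (suc j) * recip (suc j) * (recip d * (x * (recip (d ^ j) * recip (j !) * recip D)))
    ≡⟨ cong₂ (λ u r → u * (recip d * (x * r))) (n*recip[n] (suc j)) (sym collect) ⟩
  1ℚ * (recip d * (x * recip (d ^ j ℕ.* j ! ℕ.* D)))
    ≡⟨ ℚₚ.*-identityˡ _ ⟩
  recip d * (x * recip (d ^ j ℕ.* j ! ℕ.* D)) ∎
  where
  open ≡-Reasoning
  regroup : ∀ n x r p s f q → n * (x * (r * p * (s * f) * q)) ≡ n * s * (r * (x * (p * f * q)))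
  regroup = solve-∀ ring
  expand : recip (d ℕ.* d ^ j ℕ.* (suc j ℕ.* j !) ℕ.* D) ≡
           recip d * recip (d ^ j) * (recip (suc j) * recip (j !)) * recip D
  expand = trans (recip-* (d ℕ.* d ^ j ℕ.* (suc j ℕ.* j !)) D) (cong (_* recip D)
    (trans (recip-* (d ℕ.* d ^ j) (suc j ℕ.* j !)) (cong₂ _*_ (recip-* d (d ^ j)) (recip-* (suc j) (j !)))))
  collect : recip (d ^ j ℕ.* j ! ℕ.* D) ≡ recip (d ^ j) * recip (j !) * recip D
  collect = trans (recip-* (d ^ j ℕ.* j !) D) (cong (_* recip D) (recip-* (d ^ j) (j !)))

-- Substituting kᵢ + 1 for kᵢ: the terms with kᵢ = 0 drop out because of the factor kᵢ, and the
-- hypothesis on `h` removes the terms in which the raised entry would leave the box.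
lower : ∀ b {L} (d : Fin L → ℕ) i (h : Vec ℕ L → ℚ) →
  (∀ k → lookup k i ≡ b → h (k [ i ]%= suc) ≡ 0ℚ) →
  sumOver (boundedTuples b L) (λ k → fromℕ (lookup k i) * (h k * recip (denom d k)))
    ≡ recip (d i) * sumOver (boundedTuples b L) (λ k → h (k [ i ]%= suc) * recip (denom d k))
lower b {suc L} d fzero h h≡0 = begin
  sumOver (boundedTuples b (suc L)) (λ k → fromℕ (lookup k fzero) * (h k * recip (denom d k)))
    ≡⟨ sumOver-cartesian _∷_ (upTo (suc b)) K _ ⟩
  sumOver (upTo (suc b)) (λ j → sumOver K (before j))
    ≡⟨ sumOver-upTo-shift b (λ j → sumOver K (before j)) (λ j → sumOver K (after j))
        (sumOver-0 K λ k → ℚₚ.*-zeroˡ (h (0 ∷ k) * recip (denom d (0 ∷ k))))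
        (λ j → sumOver-cong K λ k → coefficient-step (d fzero) j (h (suc j ∷ k)) (denom (d ∘ fsuc) k))
        (sumOver-0 K vanish) ⟩
  sumOver (upTo (suc b)) (λ j → sumOver K (after j))
    ≡⟨ sumOver-cartesian _∷_ (upTo (suc b)) K _ ⟨
  sumOver (boundedTuples b (suc L)) (λ k → recip (d fzero) * (h (k [ fzero ]%= suc) * recip (denom d k)))
    ≡⟨ sumOver-* (boundedTuples b (suc L)) (recip (d fzero)) _ ⟩
  recip (d fzero) * sumOver (boundedTuples b (suc L)) (λ k → h (k [ fzero ]%= suc) * recip (denom d k)) ∎
  where
  open ≡-Reasoning
  K : List (Vec ℕ L)
  K = boundedTuples b L
  before after : ℕ → Vec ℕ L → ℚ
  before j k = fromℕ j * (h (j ∷ k) * recip (denom d (j ∷ k)))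
  after j k = recip (d fzero) * (h (suc j ∷ k) * recip (denom d (j ∷ k)))
  vanish : ∀ k → after b k ≡ 0ℚ
  vanish k = trans (cong (recip (d fzero) *_)
    (trans (cong (_* recip (denom d (b ∷ k))) (h≡0 (b ∷ k) refl)) (ℚₚ.*-zeroˡ (recip (denom d (b ∷ k))))))
    (ℚₚ.*-zeroʳ (recip (d fzero)))
lower b {suc L} d (fsuc i) h h≡0 = begin
  sumOver (boundedTuples b (suc L)) (λ k → fromℕ (lookup k (fsuc i)) * (h k * recip (denom d k)))
    ≡⟨ sumOver-cartesian _∷_ (upTo (suc b)) K _ ⟩
  sumOver (upTo (suc b)) (λ j → sumOver K λ k → fromℕ (lookup k i) * (h (j ∷ k) * recip (denom d (j ∷ k))))
    ≡⟨ sumOver-cong (upTo (suc b)) (λ j → trans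
        (sumOver-cong K λ k → cong (fromℕ (lookup k i) *_) (absorb j k (h (j ∷ k))))
        (trans (lower b (d ∘ fsuc) i (λ k → c j * h (j ∷ k)) (λ k eq → vanish j k eq))
          (cong (recip (d (fsuc i)) *_) (sumOver-cong K λ k → sym (absorb j k (h (j ∷ (k [ i ]%= suc)))))))) ⟩
  sumOver (upTo (suc b)) (λ j → recip (d (fsuc i)) * sumOver K λ k → h (j ∷ (k [ i ]%= suc)) * recip (denom d (j ∷ k)))
    ≡⟨ sumOver-* (upTo (suc b)) (recip (d (fsuc i))) _ ⟩
  recip (d (fsuc i)) * sumOver (upTo (suc b)) (λ j → sumOver K λ k → h (j ∷ (k [ i ]%= suc)) * recip (denom d (j ∷ k)))
    ≡⟨ cong (recip (d (fsuc i)) *_) (sumOver-cartesian _∷_ (upTo (suc b)) K _) ⟨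
  recip (d (fsuc i)) * sumOver (boundedTuples b (suc L)) (λ k → h (k [ fsuc i ]%= suc) * recip (denom d k)) ∎
  where
  open ≡-Reasoning
  K : List (Vec ℕ L)
  K = boundedTuples b L
  c : ℕ → ℚ
  c j = recip (d fzero ^ j ℕ.* j !)
  swap : ∀ x c r → x * (c * r) ≡ c * x * r
  swap = solve-∀ ring
  -- Moving the factor of the first coordinate into `h` leaves a sum of the same shape over the
  -- tail, to which the induction applies.
  absorb : ∀ j k x → x * recip (denom d (j ∷ k)) ≡ c j * x * recip (denom (d ∘ fsuc) k)
  absorb j k x = trans (cong (x *_) (recip-* (d fzero ^ j ℕ.* j !) (denom (d ∘ fsuc) k)))
    (swap x (c j) (recip (denom (d ∘ fsuc) k)))
  vanish : ∀ j k → lookup k i ≡ b → c j * h (j ∷ (k [ i ]%= suc)) ≡ 0ℚ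
  vanish j k eq = trans (cong (c j *_) (h≡0 (j ∷ k) eq)) (ℚₚ.*-zeroʳ (c j))

linear-form-lower : ∀ b {L} (d : Fin L → ℕ) (u : Fin L → ℚ) (h : Vec ℕ L → ℚ) →
  (∀ i k → lookup k i ≡ b → h (k [ i ]%= suc) ≡ 0ℚ) →
  sumOver (boundedTuples b L) (λ k → ∑[ i < L ] (u i * fromℕ (lookup k i)) * (h k * recip (denom d k)))
    ≡ ∑[ i < L ] (u i * (recip (d i) * sumOver (boundedTuples b L) (λ k → h (k [ i ]%= suc) * recip (denom d k))))
linear-form-lower b {L} d u h h≡0 = begin
  sumOver K (λ k → ∑[ i < L ] (u i * fromℕ (lookup k i)) * (h k * recip (denom d k)))
    ≡⟨ sumOver-cong K (λ k → trans (ℚ∑.*-distribʳ-sum {L} (h k * recip (denom d k)) (λ i → u i * fromℕ (lookup k i)))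
        (ℚ∑.sum-cong-≗ {L} λ i → ℚₚ.*-assoc (u i) (fromℕ (lookup k i)) _)) ⟩
  sumOver K (λ k → ∑[ i < L ] (u i * (fromℕ (lookup k i) * (h k * recip (denom d k)))))
    ≡⟨ sumOver-∑ K {L} _ ⟩
  ∑[ i < L ] sumOver K (λ k → u i * (fromℕ (lookup k i) * (h k * recip (denom d k))))
    ≡⟨ ℚ∑.sum-cong-≗ {L} (λ i → trans (sumOver-* K (u i) _) (cong (u i *_) (lower b d i h (h≡0 i)))) ⟩
  ∑[ i < L ] (u i * (recip (d i) * sumOver K (λ k → h (k [ i ]%= suc) * recip (denom d k)))) ∎
  where
  open ≡-Reasoning
  K : List (Vec ℕ L)
  K = boundedTuples b L

-- Linear forms in the entries of a tuple.

sum-[]%= : ∀ {L} (k : Vec ℕ L) i → sum (k [ i ]%= suc) ≡ suc (sum k)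
sum-[]%= (j ∷ k) fzero    = refl
sum-[]%= (j ∷ k) (fsuc i) = trans (cong (_+_ j) (sum-[]%= k i)) (ℕₚ.+-suc j (sum k))

-- Weights with arbitrary entries, as induction on the tuple shifts the indices.
weigh : ∀ {L} → (Fin L → ℕ) → Vec ℕ L → ℕ
weigh {L} v k = ℕ∑.sum {L} λ i → v i ℕ.* lookup k i

weigh-[]%= : ∀ {L} (v : Fin L → ℕ) k i → weigh v (k [ i ]%= suc) ≡ v i + weigh v k
weigh-[]%= v (j ∷ k) fzero = trans (cong (_+ weigh (v ∘ fsuc) k) (ℕₚ.*-suc (v fzero) j))
  (ℕₚ.+-assoc (v fzero) (v fzero ℕ.* j) _)
weigh-[]%= v (j ∷ k) (fsuc i) = trans (cong (_+_ (v fzero ℕ.* j)) (weigh-[]%= (v ∘ fsuc) k i))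
  (exchange (v fzero ℕ.* j) (v (fsuc i)) _)
  where
  exchange : ∀ a b c → a + (b + c) ≡ b + (a + c)
  exchange = solveℕ

weigh≥ : ∀ {L} (v : Fin L → ℕ) k i → v i ℕ.* lookup k i ≤ weigh v k
weigh≥ v (j ∷ k) fzero    = ℕₚ.m≤m+n _ _
weigh≥ v (j ∷ k) (fsuc i) = ℕₚ.≤-trans (weigh≥ (v ∘ fsuc) k i) (ℕₚ.m≤n+m _ _)

fromℕ-weigh : ∀ {L} (v : Fin L → ℕ) k → fromℕ (weigh v k) ≡ ∑[ i < L ] (fromℕ (v i) * fromℕ (lookup k i))
fromℕ-weigh v []      = refl
fromℕ-weigh v (j ∷ k) = trans (fromℕ-+ (v fzero ℕ.* j) (weigh (v ∘ fsuc) k))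
  (cong₂ ℚ._+_ (fromℕ-* (v fzero) j) (fromℕ-weigh (v ∘ fsuc) k))

sum≡weigh : ∀ {L} (k : Vec ℕ L) → sum k ≡ weigh (λ _ → 1) k
sum≡weigh []      = refl
sum≡weigh (j ∷ k) = cong₂ _+_ (sym (ℕₚ.+-identityʳ j)) (sum≡weigh k)

-- All weights are positive, so only the zero tuple survives, and its denominator is 1. This
-- supplies the starting value of `τ` at weight 0.
sumOver-weigh0 : ∀ b {L} (v d : Fin L → ℕ) (f : ℕ → ℚ) →
  sumOver (boundedTuples b L) (λ k → δ (weigh (suc ∘ v) k) 0 * f (sum k) * recip (denom d k)) ≡ f 0
sumOver-weigh0 b {zero} v d f = drop (f 0)
  where
  drop : ∀ x → 1ℚ * x * 1ℚ ℚ.+ 0ℚ ≡ x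
  drop = solve-∀ ring
sumOver-weigh0 b {suc L} v d f = begin
  sumOver (boundedTuples b (suc L)) (term (suc ∘ v) d)
    ≡⟨ sumOver-cartesian _∷_ (upTo (suc b)) K _ ⟩
  sumOver (upTo (suc b)) g
    ≡⟨ sumOver-applyUpTo id (suc b) g ⟩
  g 0 ℚ.+ ∑[ j < b ] g (suc (toℕ j))
    ≡⟨ cong₂ ℚ._+_ (sumOver-cong K head) (trans (ℚ∑.sum-cong-≗ {b} (tail ∘ toℕ)) (ℚ∑.sum-replicate-zero b)) ⟩
  sumOver K (term (suc ∘ v ∘ fsuc) (d ∘ fsuc)) ℚ.+ 0ℚ
    ≡⟨ ℚₚ.+-identityʳ (sumOver K (term (suc ∘ v ∘ fsuc) (d ∘ fsuc))) ⟩
  sumOver K (term (suc ∘ v ∘ fsuc) (d ∘ fsuc))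
    ≡⟨ sumOver-weigh0 b (v ∘ fsuc) (d ∘ fsuc) f ⟩
  f 0 ∎
  where
  open ≡-Reasoning
  K : List (Vec ℕ L)
  K = boundedTuples b L
  term : ∀ {L} → (Fin L → ℕ) → (Fin L → ℕ) → Vec ℕ L → ℚ
  term v d k = δ (weigh v k) 0 * f (sum k) * recip (denom d k)
  g : ℕ → ℚ
  g j = sumOver K (λ k → term (suc ∘ v) d (j ∷ k))
  head : ∀ k → term (suc ∘ v) d (0 ∷ k) ≡ term (suc ∘ v ∘ fsuc) (d ∘ fsuc) k
  head k = cong₂ (λ w D → δ w 0 * f (sum k) * recip D)
    (cong (_+ weigh (suc ∘ v ∘ fsuc) k) (ℕₚ.*-zeroʳ (suc (v fzero)))) (ℕₚ.+-identityʳ (denom (d ∘ fsuc) k))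
  tail : ∀ j → g (suc j) ≡ 0ℚ
  tail j = sumOver-0 K λ k → annihilate (f (suc j + sum k)) (recip (denom d (suc j ∷ k)))

-- The signed factorial in the numerators.

signed! : ℕ → ℕ → ℚ
signed! M c = fromℤ (-1ℤ ℤ.^ c ℤ.* + ((c + M) !))

-- Raising an entry raises the sum `c` by one, which is traded for a larger offset `M` and a change
-- of sign. Hence the M + 1 and the minus sign in `moment`.
signed!-suc : ∀ M c → signed! M (suc c) ≡ ℚ.- signed! (suc M) c
signed!-suc M c = begin
  fromℤ (-1ℤ ℤ.* e ℤ.* + ((suc c + M) !))        ≡⟨ cong fromℤ (ringℤ e (+ ((suc c + M) !))) ⟩
  fromℤ (-1ℤ ℤ.* (e ℤ.* + ((suc c + M) !)))      ≡⟨ fromℤ-* -1ℤ (e ℤ.* + ((suc c + M) !)) ⟩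
  ℚ.- 1ℚ * fromℤ (e ℤ.* + ((suc c + M) !))       ≡⟨ neg (fromℤ (e ℤ.* + ((suc c + M) !))) ⟩
  ℚ.- fromℤ (e ℤ.* + ((suc c + M) !))            ≡⟨ cong (λ m → ℚ.- fromℤ (e ℤ.* + (m !))) (ℕₚ.+-suc c M) ⟨
  ℚ.- signed! (suc M) c                          ∎
  where
  open ≡-Reasoning
  e : ℤ
  e = -1ℤ ℤ.^ c
  ringℤ : ∀ e x → -1ℤ ℤ.* e ℤ.* x ≡ -1ℤ ℤ.* (e ℤ.* x)
  ringℤ = solveℤ

-- The factor c + M + 1 split off from the factorial contains `c`, the sum of the entries: this is
-- how that linear form enters the tuple sums.
signed!-step : ∀ M c → signed! (suc M) c ≡ (fromℕ c ℚ.+ fromℕ (suc M)) * signed! M c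
signed!-step M c = begin
  fromℤ (e ℤ.* + ((c + suc M) !))                     ≡⟨ cong (λ m → fromℤ (e ℤ.* + (m !))) (ℕₚ.+-suc c M) ⟩
  fromℤ (e ℤ.* + (suc (c + M) ℕ.* (c + M) !))         ≡⟨ cong (λ x → fromℤ (e ℤ.* x)) (ℤₚ.pos-* (suc (c + M)) ((c + M) !)) ⟩
  fromℤ (e ℤ.* (+ suc (c + M) ℤ.* + ((c + M) !)))     ≡⟨ cong fromℤ (ringℤ e (+ suc (c + M)) (+ ((c + M) !))) ⟩
  fromℤ (+ suc (c + M) ℤ.* (e ℤ.* + ((c + M) !)))     ≡⟨ fromℤ-* (+ suc (c + M)) (e ℤ.* + ((c + M) !)) ⟩
  fromℕ (suc (c + M)) * signed! M c                   ≡⟨ cong (λ m → fromℕ m * signed! M c) (ℕₚ.+-suc c M) ⟨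
  fromℕ (c + suc M) * signed! M c                     ≡⟨ cong (_* signed! M c) (fromℕ-+ c (suc M)) ⟩
  (fromℕ c ℚ.+ fromℕ (suc M)) * signed! M c           ∎
  where
  open ≡-Reasoning
  e : ℤ
  e = -1ℤ ℤ.^ c
  ringℤ : ∀ e x y → e ℤ.* (x ℤ.* y) ≡ x ℤ.* (e ℤ.* y)
  ringℤ = solveℤ

-- Relations between tuple sums for arbitrary denominators.

module TupleSum (L : ℕ) (d : Fin L → ℕ) where

  box : List (Vec ℕ L)
  box = boundedTuples L L

  -- The sum over the tuples of weight n ∸ j, or 0 if j > n.  The length and the bound on the entries
  -- stay L while n varies, which is harmless for n ≤ L.
  τ : ℕ → ℕ → ℕ → ℚ
  τ M n j = sumOver box λ k → δ (j + weight k) n * signed! M (sum k) * recip (denom d k)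

  τ-zero : ∀ M n j → n < j → τ M n j ≡ 0ℚ
  τ-zero M n j n<j = sumOver-0 box λ k → trans
    (cong (λ x → x * signed! M (sum k) * recip (denom d k))
      (δ-≢ (ℕₚ.>⇒≢ (ℕₚ.≤-trans n<j (ℕₚ.m≤m+n j (weight k))))))
    (annihilate (signed! M (sum k)) (recip (denom d k)))

  τ-00 : ∀ M → τ M 0 0 ≡ fromℕ (M !)
  τ-00 M = trans (sumOver-weigh0 L {L} toℕ d (signed! M)) (cong fromℤ (ℤₚ.*-identityˡ (+ (M !))))

  -- Lowering is applied to each coordinate in turn. Raising coordinate i adds i + 1 to the weight,
  -- which is the last argument of `τ` on the right.
  moment : ∀ M n → n ≤ L → (v : Fin L → ℕ) →
    sumOver box (λ k → fromℕ (weigh v k) * (δ (weight k) n * signed! M (sum k) * recip (denom d k)))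
      ≡ ∑[ i < L ] (fromℕ (v i) * (recip (d i) * (ℚ.- τ (suc M) n (suc (toℕ i)))))
  moment M n n≤L v = begin
    sumOver box (λ k → fromℕ (weigh v k) * (h k * recip (denom d k)))
      ≡⟨ sumOver-cong box (λ k → cong (_* (h k * recip (denom d k))) (fromℕ-weigh v k)) ⟩
    sumOver box (λ k → ∑[ i < L ] (fromℕ (v i) * fromℕ (lookup k i)) * (h k * recip (denom d k)))
      ≡⟨ linear-form-lower L d (fromℕ ∘ v) h vanish ⟩
    ∑[ i < L ] (fromℕ (v i) * (recip (d i) * sumOver box (λ k → h (k [ i ]%= suc) * recip (denom d k))))
      ≡⟨ ℚ∑.sum-cong-≗ {L} (λ i → cong (λ x → fromℕ (v i) * (recip (d i) * x)) (raised i)) ⟩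
    ∑[ i < L ] (fromℕ (v i) * (recip (d i) * (ℚ.- τ (suc M) n (suc (toℕ i))))) ∎
    where
    open ≡-Reasoning
    h : Vec ℕ L → ℚ
    h k = δ (weight k) n * signed! M (sum k)
    weight-[]%= : ∀ k i → weight (k [ i ]%= suc) ≡ suc (toℕ i) + weight k
    weight-[]%= = weigh-[]%= (suc ∘ toℕ)
    vanish : ∀ i k → lookup k i ≡ L → h (k [ i ]%= suc) ≡ 0ℚ
    -- An entry equal to L already forces a weight of at least L, hence of at least n, so raising it
    -- overshoots n.
    vanish i k kᵢ≡L = trans (cong (_* signed! M (sum (k [ i ]%= suc))) (δ-≢ (ℕₚ.>⇒≢ n<)))
      (ℚₚ.*-zeroˡ (signed! M (sum (k [ i ]%= suc))))
      where
      L≤weight : L ≤ weight k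
      L≤weight = ℕₚ.≤-trans (ℕₚ.≤-trans (ℕₚ.≤-reflexive (sym kᵢ≡L)) (ℕₚ.m≤n*m (lookup k i) (suc (toℕ i))))
        (weigh≥ (suc ∘ toℕ) k i)
      n< : n < weight (k [ i ]%= suc)
      n< = subst (n <_) (sym (weight-[]%= k i))
        (s≤s (ℕₚ.≤-trans n≤L (ℕₚ.≤-trans L≤weight (ℕₚ.m≤n+m (weight k) (toℕ i)))))
    pull : ∀ x s p → x * (ℚ.- s) * p ≡ (ℚ.- 1ℚ) * (x * s * p)
    pull = solve-∀ ring
    raised-term : ∀ i k → h (k [ i ]%= suc) * recip (denom d k) ≡
      (ℚ.- 1ℚ) * (δ (suc (toℕ i) + weight k) n * signed! (suc M) (sum k) * recip (denom d k))
    raised-term i k = trans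
      (cong (_* recip (denom d k)) (cong₂ (λ w s → δ w n * s) (weight-[]%= k i)
        (trans (cong (signed! M) (sum-[]%= k i)) (signed!-suc M (sum k)))))
      (pull (δ (suc (toℕ i) + weight k) n) (signed! (suc M) (sum k)) (recip (denom d k)))
    raised : ∀ i → sumOver box (λ k → h (k [ i ]%= suc) * recip (denom d k)) ≡ ℚ.- τ (suc M) n (suc (toℕ i))
    raised i = trans (sumOver-cong box (raised-term i))
      (trans (sumOver-* box (ℚ.- 1ℚ) _) (neg (τ (suc M) n (suc (toℕ i)))))

  weightedSum : (Fin L → ℕ) → ℕ → ℕ → ℚ
  weightedSum v M n = sumOver box λ k → fromℕ (weigh v k) * (δ (weight k) n * signed! M (sum k) * recip (denom d k))

  -- This is `moment` with both sides brought together. The coefficients are given by a function `a`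
  -- on ℕ so that `extend` can reindex them beyond L.
  weightedSum-cancel : ∀ M n → n ≤ L → (v : Fin L → ℕ) (a : ℕ → ℚ) →
    (∀ i → fromℕ (v i) * recip (d i) ≡ a (toℕ i)) →
    weightedSum v M n ℚ.+ ∑[ i < L ] (a (toℕ i) * τ (suc M) n (suc (toℕ i))) ≡ 0ℚ
  weightedSum-cancel M n n≤L v a va = begin
    weightedSum v M n ℚ.+ ∑[ i < L ] (a (toℕ i) * t i)
      ≡⟨ cong (ℚ._+ ∑[ i < L ] (a (toℕ i) * t i)) (moment M n n≤L v) ⟩
    ∑[ i < L ] (fromℕ (v i) * (recip (d i) * (ℚ.- t i))) ℚ.+ ∑[ i < L ] (a (toℕ i) * t i)
      ≡⟨ ℚ∑.∑-distrib-+ {L} (λ i → fromℕ (v i) * (recip (d i) * (ℚ.- t i))) (λ i → a (toℕ i) * t i) ⟨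
    ∑[ i < L ] (fromℕ (v i) * (recip (d i) * (ℚ.- t i)) ℚ.+ a (toℕ i) * t i)
      ≡⟨ ℚ∑.sum-cong-≗ {L} cancel ⟩
    ∑[ i < L ] 0ℚ
      ≡⟨ ℚ∑.sum-replicate-zero L ⟩
    0ℚ ∎
    where
    open ≡-Reasoning
    t : Fin L → ℚ
    t i = τ (suc M) n (suc (toℕ i))
    cancel-ring : ∀ u r x → u * (r * (ℚ.- x)) ℚ.+ u * r * x ≡ 0ℚ
    cancel-ring = solve-∀ ring
    cancel : ∀ i → fromℕ (v i) * (recip (d i) * (ℚ.- t i)) ℚ.+ a (toℕ i) * t i ≡ 0ℚ
    cancel i = trans (cong (λ x → fromℕ (v i) * (recip (d i) * (ℚ.- t i)) ℚ.+ x * t i) (sym (va i)))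
      (cancel-ring (fromℕ (v i)) (recip (d i)) (t i))

  τ-suc : ∀ M n → τ (suc M) n 0 ≡ weightedSum (λ _ → 1) M n ℚ.+ fromℕ (suc M) * τ M n 0
  τ-suc M n = begin
    τ (suc M) n 0
      ≡⟨ sumOver-cong box split ⟩
    sumOver box (λ k → fromℕ (weigh (λ _ → 1) k) * x k ℚ.+ fromℕ (suc M) * x k)
      ≡⟨ sumOver-+ box (λ k → fromℕ (weigh (λ _ → 1) k) * x k) (λ k → fromℕ (suc M) * x k) ⟩
    weightedSum (λ _ → 1) M n ℚ.+ sumOver box (λ k → fromℕ (suc M) * x k)
      ≡⟨ cong (weightedSum (λ _ → 1) M n ℚ.+_) (sumOver-* box (fromℕ (suc M)) x) ⟩
    weightedSum (λ _ → 1) M n ℚ.+ fromℕ (suc M) * τ M n 0 ∎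
    where
    open ≡-Reasoning
    x : Vec ℕ L → ℚ
    x k = δ (weight k) n * signed! M (sum k) * recip (denom d k)
    distribute : ∀ e s m y r → e * ((s ℚ.+ m) * y) * r ≡ s * (e * y * r) ℚ.+ m * (e * y * r)
    distribute = solve-∀ ring
    split : ∀ k → δ (weight k) n * signed! (suc M) (sum k) * recip (denom d k) ≡
      fromℕ (weigh (λ _ → 1) k) * x k ℚ.+ fromℕ (suc M) * x k
    split k = trans
      (cong (λ y → δ (weight k) n * y * recip (denom d k)) (signed!-step M (sum k)))
      (trans (distribute (δ (weight k) n) (fromℕ (sum k)) (fromℕ (suc M)) (signed! M (sum k)) (recip (denom d k)))
        (cong (λ s → fromℕ s * x k ℚ.+ fromℕ (suc M) * x k) (sum≡weigh k)))

  -- The weights i + 2 = 1 + (i + 1) give the sum of the entries plus the weight, and the weight may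
  -- be replaced by n because of the delta factor.
  weightedSum-suc : ∀ M n →
    weightedSum (λ i → suc (suc (toℕ i))) M n ≡ weightedSum (λ _ → 1) M n ℚ.+ fromℕ n * τ M n 0
  weightedSum-suc M n = begin
    weightedSum (λ i → suc (suc (toℕ i))) M n
      ≡⟨ sumOver-cong box split ⟩
    sumOver box (λ k → fromℕ (weigh (λ _ → 1) k) * x k ℚ.+ fromℕ n * x k)
      ≡⟨ sumOver-+ box (λ k → fromℕ (weigh (λ _ → 1) k) * x k) (λ k → fromℕ n * x k) ⟩
    weightedSum (λ _ → 1) M n ℚ.+ sumOver box (λ k → fromℕ n * x k)
      ≡⟨ cong (weightedSum (λ _ → 1) M n ℚ.+_) (sumOver-* box (fromℕ n) x) ⟩
    weightedSum (λ _ → 1) M n ℚ.+ fromℕ n * τ M n 0 ∎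
    where
    open ≡-Reasoning
    x : Vec ℕ L → ℚ
    x k = δ (weight k) n * signed! M (sum k) * recip (denom d k)
    ringℕ : ∀ a v → (1 + v) ℕ.* a ≡ 1 ℕ.* a + v ℕ.* a
    ringℕ = solveℕ
    weigh-suc : ∀ k → weigh (λ i → suc (suc (toℕ i))) k ≡ weigh (λ _ → 1) k + weight k
    weigh-suc k = trans (ℕ∑.sum-cong-≗ {L} λ i → ringℕ (lookup k i) (suc (toℕ i)))
      (ℕ∑′.∑-distrib-+ {L} (λ i → 1 ℕ.* lookup k i) (λ i → suc (toℕ i) ℕ.* lookup k i))
    move : ∀ w e y r → w * (e * y * r) ≡ w * e * (y * r)
    move = solve-∀ ring
    at-weight : ∀ k → fromℕ (weight k) * x k ≡ fromℕ n * x k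
    at-weight k = trans (move (fromℕ (weight k)) (δ (weight k) n) (signed! M (sum k)) (recip (denom d k)))
      (trans (cong (_* (signed! M (sum k) * recip (denom d k))) (δ-subst fromℕ (weight k) n))
        (sym (move (fromℕ n) (δ (weight k) n) (signed! M (sum k)) (recip (denom d k)))))
    split : ∀ k → fromℕ (weigh (λ i → suc (suc (toℕ i))) k) * x k ≡
      fromℕ (weigh (λ _ → 1) k) * x k ℚ.+ fromℕ n * x k
    split k = trans (cong (_* x k) (trans (cong fromℕ (weigh-suc k)) (fromℕ-+ (weigh (λ _ → 1) k) (weight k))))
      (trans (ℚₚ.*-distribʳ-+ (x k) (fromℕ (weigh (λ _ → 1) k)) (fromℕ (weight k)))
        (cong (fromℕ (weigh (λ _ → 1) k) * x k ℚ.+_) (at-weight k)))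

  -- With A = 1 + Σ yʲ/dⱼ one has τ M n 0 = M! [yⁿ] A^(-M-1).  The two relations below compare
  -- coefficients in A A^(-M-2) = A^(-M-1) and in its combination with y (A^(-M-1))′.
  power-relation : ∀ M n → n ≤ L → (a : ℕ → ℚ) → (∀ i → recip (d i) ≡ a (toℕ i)) →
    τ (suc M) n 0 ℚ.+ ∑[ i < L ] (a (toℕ i) * τ (suc M) n (suc (toℕ i))) ≡ fromℕ (suc M) * τ M n 0
  power-relation M n n≤L a a≡ = eliminate (weightedSum (λ _ → 1) M n) (τ-suc M n)
    (weightedSum-cancel M n n≤L (λ _ → 1) a λ i → trans (ℚₚ.*-identityˡ (recip (d i))) (a≡ i))
    where
    ringℚ : ∀ E y z → E ℚ.+ y ℚ.+ z ≡ (E ℚ.+ z) ℚ.+ y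
    ringℚ = solve-∀ ring
    eliminate : ∀ {x y z} E → x ≡ E ℚ.+ y → E ℚ.+ z ≡ 0ℚ → x ℚ.+ z ≡ y
    eliminate {x} {y} {z} E p q = trans (cong (ℚ._+ z) p)
      (trans (ringℚ E y z) (trans (cong (ℚ._+ y) q) (ℚₚ.+-identityˡ y)))

  derivative-relation : ∀ M n → n ≤ L → (a : ℕ → ℚ) →
    (∀ i → fromℕ (suc (suc (toℕ i))) * recip (d i) ≡ a (toℕ i)) →
    τ (suc M) n 0 ℚ.+ ∑[ i < L ] (a (toℕ i) * τ (suc M) n (suc (toℕ i)))
      ≡ (fromℕ (suc M) ℚ.- fromℕ n) * τ M n 0
  derivative-relation M n n≤L a a≡ =
    eliminate (weightedSum (λ _ → 1) M n) (fromℕ (suc M)) (fromℕ n) (τ-suc M n) (weightedSum-suc M n)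
    (weightedSum-cancel M n n≤L (λ i → suc (suc (toℕ i))) a a≡)
    where
    ringℚ : ∀ E m t n z → E ℚ.+ m * t ℚ.+ z ≡ (E ℚ.+ n * t ℚ.+ z) ℚ.+ (m ℚ.- n) * t
    ringℚ = solve-∀ ring
    eliminate : ∀ {x F t z} E m n → x ≡ E ℚ.+ m * t → F ≡ E ℚ.+ n * t → F ℚ.+ z ≡ 0ℚ → x ℚ.+ z ≡ (m ℚ.- n) * t
    eliminate {x} {F} {t} {z} E m n p q r = trans (cong (ℚ._+ z) p)
      (trans (ringℚ E m t n z) (trans (cong (λ y → y ℚ.+ z ℚ.+ (m ℚ.- n) * t) (sym q))
        (trans (cong (ℚ._+ (m ℚ.- n) * t) r) (ℚₚ.+-identityˡ ((m ℚ.- n) * t)))))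

  Recurrence : (ℕ → ℕ → ℕ) → Set
  Recurrence c = ∀ n m → n < L →
    τ (suc (n + m)) (suc n) 0 ≡ fromℕ m * τ (n + m) (suc n) 0 ℚ.- fromℕ (c n m) * τ (n + m) n 0

  -- Since `δ (suc _) (suc _)` computes, `τ M (suc n) (suc j)` is `τ M n j` by definition. The added
  -- term j = L vanishes because `n < L`.
  extend : ∀ M n (a : ℕ → ℚ) → n < L →
    ∑[ i < L ] (a (toℕ i) * τ M (suc n) (suc (toℕ i))) ≡ ∑[ i < suc L ] (a (toℕ i) * τ M n (toℕ i))
  extend M n a n<L = sym (trans (∑-last L (λ i → a i * τ M n i))
    (trans (cong (∑[ i < L ] (a (toℕ i) * τ M n (toℕ i)) ℚ.+_)
      (trans (cong (a L *_) (τ-zero M n L n<L)) (ℚₚ.*-zeroʳ (a L))))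
      (ℚₚ.+-identityʳ (∑[ i < L ] (a (toℕ i) * τ M n (toℕ i))))))

  -- This is `derivative-relation` at weight n + 1 and offset n + m, where the coefficient collapses
  -- to m. After the shift by `extend`, its terms with j ≥ 1 are evaluated by the last hypothesis, a
  -- relation at weight n.
  recurrence : ∀ (c : ℕ → ℕ → ℕ) (a : ℕ → ℚ) →
    (∀ i → fromℕ (suc (suc (toℕ i))) * recip (d i) ≡ a (toℕ i)) →
    (∀ n m → n < L → ∑[ i < suc L ] (a (toℕ i) * τ (suc (n + m)) n (toℕ i)) ≡ fromℕ (c n m) * τ (n + m) n 0) →
    Recurrence c
  recurrence c a a≡ rest n m n<L = isolate (trans
    (cong (τ (suc (n + m)) (suc n) 0 ℚ.+_) (sym (trans (extend (suc (n + m)) n a n<L) (rest n m n<L))))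
    (trans (derivative-relation (n + m) (suc n) n<L a a≡) (cong (_* τ (n + m) (suc n) 0) coefficient)))
    where
    ringℚ : ∀ x z → x ≡ x ℚ.+ z ℚ.- z
    ringℚ = solve-∀ ring
    isolate : ∀ {x y z} → x ℚ.+ z ≡ y → x ≡ y ℚ.- z
    isolate {x} {y} {z} p = trans (ringℚ x z) (cong (ℚ._- z) p)
    coefficient : fromℕ (suc (n + m)) ℚ.- fromℕ (suc n) ≡ fromℕ m
    coefficient = trans (cong (ℚ._- fromℕ (suc n)) (fromℕ-+ (suc n) m)) (minus (fromℕ (suc n)) (fromℕ m))

-- The three-term recurrence for the two families of denominators.

module Powers (L : ℕ) where

  open TupleSum L (λ i → suc (suc (toℕ i))) public

  -- All coefficients are 1, so the shifted sum is the left side of `derivative-relation` at n, with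
  -- coefficient (n + m + 1) - n.
  powers-recurrence : Recurrence λ n m → suc m
  powers-recurrence = recurrence (λ n m → suc m) (λ _ → 1ℚ) (λ i → n*recip[n] (suc (suc (toℕ i)))) λ n m n<L →
    trans (cong (ℚ._+ ∑[ i < L ] (1ℚ * τ (suc (n + m)) n (suc (toℕ i)))) (ℚₚ.*-identityˡ (τ (suc (n + m)) n 0)))
    (trans (derivative-relation (n + m) n (ℕₚ.<⇒≤ n<L) (λ _ → 1ℚ) (λ i → n*recip[n] (suc (suc (toℕ i)))))
      (cong (_* τ (n + m) n 0) (coefficient n m)))
    where
    coefficient : ∀ n m → fromℕ (suc (n + m)) ℚ.- fromℕ n ≡ fromℕ (suc m)
    coefficient n m = trans (cong (λ x → fromℕ x ℚ.- fromℕ n) (sym (ℕₚ.+-suc n m)))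
      (trans (cong (ℚ._- fromℕ n) (fromℕ-+ n (suc m))) (minus (fromℕ n) (fromℕ (suc m))))

module Factorials (L : ℕ) where

  open TupleSum L (λ i → suc (suc (toℕ i)) !) public

  -- The coefficients 1/(i + 1)! start with 1 and continue with the reciprocals of the denominators,
  -- so the shifted sum is the left side of `power-relation` at n.
  factorials-recurrence : Recurrence λ n m → n + suc m
  factorials-recurrence = recurrence (λ n m → n + suc m) (λ i → recip (suc i !)) reduce λ n m n<L →
    trans (cong (ℚ._+ ∑[ i < L ] (recip (suc (suc (toℕ i)) !) * τ (suc (n + m)) n (suc (toℕ i))))
            (ℚₚ.*-identityˡ (τ (suc (n + m)) n 0)))
    (trans (power-relation (n + m) n (ℕₚ.<⇒≤ n<L) (λ i → recip (suc (suc i) !)) λ _ → refl)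
      (cong (λ x → fromℕ x * τ (n + m) n 0) (sym (ℕₚ.+-suc n m))))
    where
    reduce : ∀ (i : Fin L) → fromℕ (suc (suc (toℕ i))) * recip (suc (suc (toℕ i)) !) ≡ recip (suc (toℕ i) !)
    reduce i = begin
      fromℕ k * recip (k ℕ.* r)             ≡⟨ cong (fromℕ k *_) (recip-* k r) ⟩
      fromℕ k * (recip k * recip r)         ≡⟨ ℚₚ.*-assoc (fromℕ k) (recip k) (recip r) ⟨
      fromℕ k * recip k * recip r           ≡⟨ cong (_* recip r) (n*recip[n] k) ⟩
      1ℚ * recip r                          ≡⟨ ℚₚ.*-identityˡ (recip r) ⟩
      recip r                               ∎
      where
      open ≡-Reasoning
      k r : ℕ
      k = suc (suc (toℕ i))
      r = suc (toℕ i) !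

-- Uniqueness of Newton expansions and of the Stirling numbers.

-1^n*-1^n : ∀ n → -1ℤ ℤ.^ n ℤ.* -1ℤ ℤ.^ n ≡ 1ℤ
-1^n*-1^n zero    = refl
-1^n*-1^n (suc n) = trans (ringℤ (-1ℤ ℤ.^ n)) (-1^n*-1^n n)
  where
  ringℤ : ∀ e → -1ℤ ℤ.* e ℤ.* (-1ℤ ℤ.* e) ≡ e ℤ.* e
  ringℤ = solveℤ

-- The Newton basis with nodes `c`. The nodes 0, 1, 2, ... give the falling factorials and constant
-- nodes 0 give the powers, so one uniqueness argument serves both kinds.
newton : (ℕ → ℕ) → ℤ → ℕ → ℤ
newton c x k = ℤ∏.sum {k} λ i → x ℤ.- + c (toℕ i)

newtonSum : (ℕ → ℕ) → ℕ → (ℕ → ℤ) → ℤ → ℤ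
newtonSum c n a x = ℤ∑.sum {n} λ i → a (toℕ i) ℤ.* newton c x (toℕ i)

-- Horner's scheme: all terms but the first share the factor x - c₀.
newtonSum-suc : ∀ c n a x →
  newtonSum c (suc n) a x ≡ a 0 ℤ.+ (x ℤ.- + c 0) ℤ.* newtonSum (c ∘ suc) n (a ∘ suc) x
newtonSum-suc c n a x = cong₂ ℤ._+_ (ℤₚ.*-identityʳ (a 0)) (trans
  (ℤ∑.sum-cong-≗ {n} λ i → exchange (a (suc (toℕ i))) (x ℤ.- + c 0) (newton (c ∘ suc) x (toℕ i)))
  (sym (ℤ∑.*-distribˡ-sum {n} (x ℤ.- + c 0) λ i → a (suc (toℕ i)) ℤ.* newton (c ∘ suc) x (toℕ i))))
  where
  exchange : ∀ a y p → a ℤ.* (y ℤ.* p) ≡ y ℤ.* (a ℤ.* p)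
  exchange = solveℤ

-- Here |e| = s |r|, which would be at least s if `r` were nonzero.
small-multiple≡0 : ∀ e r s → ℤ.∣ e ∣ < s → e ℤ.+ + s ℤ.* r ≡ 0ℤ → e ≡ 0ℤ
small-multiple≡0 e r s ∣e∣<s e+sr≡0 = by-size ℤ.∣ r ∣ refl
  where
  ringℤ : ∀ e x → e ≡ (e ℤ.+ x) ℤ.- x
  ringℤ = solveℤ
  e≡-sr : e ≡ 0ℤ ℤ.- + s ℤ.* r
  e≡-sr = trans (ringℤ e (+ s ℤ.* r)) (cong (ℤ._- + s ℤ.* r) e+sr≡0)
  ∣e∣≡s∣r∣ : ℤ.∣ e ∣ ≡ s ℕ.* ℤ.∣ r ∣
  ∣e∣≡s∣r∣ = trans (cong ℤ.∣_∣ (trans e≡-sr (ℤₚ.+-identityˡ (ℤ.- (+ s ℤ.* r)))))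
    (trans (ℤₚ.∣-i∣≡∣i∣ (+ s ℤ.* r)) (ℤₚ.abs-* (+ s) r))
  by-size : ∀ q → ℤ.∣ r ∣ ≡ q → e ≡ 0ℤ
  by-size zero    ∣r∣≡0 = ℤₚ.∣i∣≡0⇒i≡0 (trans ∣e∣≡s∣r∣ (trans (cong (s ℕ.*_) ∣r∣≡0) (ℕₚ.*-zeroʳ s)))
  by-size (suc q) ∣r∣≡  = contradiction
    (ℕₚ.≤-trans (ℕₚ.m≤m*n s (suc q)) (ℕₚ.≤-reflexive (sym (trans ∣e∣≡s∣r∣ (cong (s ℕ.*_) ∣r∣≡)))))
    (ℕₚ.<⇒≱ ∣e∣<s)

-- The identity is needed at large x only: there x - c₀ ≠ 0 can be divided out, and it exceeds
-- the constant coefficient, which it divides.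
newtonSum≡0⇒coefficients≡0 : ∀ n c a b → (∀ x → b ≤ x → newtonSum c n a (+ x) ≡ 0ℤ) → ∀ k → k < n → a k ≡ 0ℤ
newtonSum≡0⇒coefficients≡0 (suc n) c a b a≡0 = coefficient
  where
  quotient : ℕ → ℤ
  quotient x = newtonSum (c ∘ suc) n (a ∘ suc) (+ x)
  split : ∀ x → b ≤ x → a 0 ℤ.+ (+ x ℤ.- + c 0) ℤ.* quotient x ≡ 0ℤ
  split x b≤x = trans (sym (newtonSum-suc c n a (+ x))) (a≡0 x b≤x)
  s x₀ : ℕ
  -- The summand `b` puts x₀ in the range where the identity holds, and the rest makes x₀ - c₀ = s
  -- larger than |a 0|.
  s = suc (b + ℤ.∣ a 0 ∣)
  x₀ = c 0 + s
  cancel : ∀ c s → c ℤ.+ s ℤ.- c ≡ s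
  cancel = solveℤ
  x₀-c₀ : + x₀ ℤ.- + c 0 ≡ + s
  x₀-c₀ = trans (cong (ℤ._- + c 0) (ℤₚ.pos-+ (c 0) s)) (cancel (+ c 0) (+ s))
  a₀≡0 : a 0 ≡ 0ℤ
  a₀≡0 = small-multiple≡0 (a 0) (quotient x₀) s (s≤s (ℕₚ.m≤n+m ℤ.∣ a 0 ∣ b))
    (trans (cong (λ y → a 0 ℤ.+ y ℤ.* quotient x₀) (sym x₀-c₀))
      (split x₀ (ℕₚ.≤-trans (ℕₚ.m≤n⇒m≤1+n (ℕₚ.m≤m+n b _)) (ℕₚ.m≤n+m s (c 0)))))
  quotient≡0 : ∀ x → b + suc (c 0) ≤ x → quotient x ≡ 0ℤ
  quotient≡0 x large with ℤₚ.i*j≡0⇒i≡0∨j≡0 (+ x ℤ.- + c 0)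
    (trans (sym (ℤₚ.+-identityˡ ((+ x ℤ.- + c 0) ℤ.* quotient x))) (trans (cong (ℤ._+ (+ x ℤ.- + c 0) ℤ.* quotient x) (sym a₀≡0)) (split x (ℕₚ.≤-trans (ℕₚ.m≤m+n b _) large))))
  ... | inj₁ x-c₀≡0 = contradiction
    (ℕₚ.≤-reflexive (ℤₚ.+-injective (ℤₚ.i-j≡0⇒i≡j (+ x) (+ c 0) x-c₀≡0)))
    (ℕₚ.<⇒≱ (ℕₚ.≤-trans (ℕₚ.m≤n+m (suc (c 0)) b) large))
  ... | inj₂ q≡0    = q≡0
  coefficient : ∀ k → k < suc n → a k ≡ 0ℤ
  coefficient zero    _         = a₀≡0
  coefficient (suc k) (s≤s k<n) =
    newtonSum≡0⇒coefficients≡0 n (c ∘ suc) (a ∘ suc) (b + suc (c 0)) quotient≡0 k k<n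

newtonSum-injective : ∀ n c a b → (∀ x → newtonSum c n a x ≡ newtonSum c n b x) → ∀ k → k < n → a k ≡ b k
newtonSum-injective n c a b a≡b k k<n = ℤₚ.i-j≡0⇒i≡j (a k) (b k)
  (newtonSum≡0⇒coefficients≡0 n c (λ k → a k ℤ.- b k) 0 (λ x _ → difference (+ x)) k k<n)
  where
  distribute : ∀ a b p → (a ℤ.- b) ℤ.* p ℤ.+ b ℤ.* p ≡ a ℤ.* p
  distribute = solveℤ
  subtract : ∀ x y → x ≡ (x ℤ.+ y) ℤ.- y
  subtract = solveℤ
  difference : ∀ x → newtonSum c n (λ k → a k ℤ.- b k) x ≡ 0ℤ
  difference x = begin
    newtonSum c n (λ k → a k ℤ.- b k) x
      ≡⟨ subtract _ (newtonSum c n b x) ⟩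
    newtonSum c n (λ k → a k ℤ.- b k) x ℤ.+ newtonSum c n b x ℤ.- newtonSum c n b x
      ≡⟨ cong (ℤ._- newtonSum c n b x) (ℤ∑.∑-distrib-+ {n}
           (λ i → (a (toℕ i) ℤ.- b (toℕ i)) ℤ.* newton c x (toℕ i)) (λ i → b (toℕ i) ℤ.* newton c x (toℕ i))) ⟨
    ℤ∑.sum {n} (λ i → (a (toℕ i) ℤ.- b (toℕ i)) ℤ.* newton c x (toℕ i) ℤ.+ b (toℕ i) ℤ.* newton c x (toℕ i))
      ℤ.- newtonSum c n b x
      ≡⟨ cong (ℤ._- newtonSum c n b x) (trans
           (ℤ∑.sum-cong-≗ {n} λ i → distribute (a (toℕ i)) (b (toℕ i)) (newton c x (toℕ i))) (a≡b x)) ⟩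
    newtonSum c n b x ℤ.- newtonSum c n b x
      ≡⟨ ℤₚ.+-inverseʳ (newtonSum c n b x) ⟩
    0ℤ ∎
    where open ≡-Reasoning

newton-0 : ∀ x k → newton (λ _ → 0) x k ≡ x ℤ.^ k
newton-0 x zero    = refl
newton-0 x (suc k) = cong₂ ℤ._*_ (ℤₚ.+-identityʳ x) (newton-0 x k)

IsStirling₂-unique : ∀ S → IsStirling₂ S → ∀ n .{{_ : NonZero n}} k → k ≤ n → S n k ≡ stirling₂ n k
IsStirling₂-unique S isS n k k≤n = newtonSum-injective (suc n) id (S n) (stirling₂ n)
  (λ x → trans (sym (isS n x)) (stirling₂-isStirling₂ n x)) k (s≤s k≤n)

-- Uniqueness in the basis of powers yields the signed coefficients; multiplying by the sign once
-- more removes it.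
IsStirling₁-unique : ∀ s → IsStirling₁ s → ∀ n .{{_ : NonZero n}} k → k ≤ n → s n k ≡ stirling₁ n k
IsStirling₁-unique s isS n k k≤n = begin
  s n k                       ≡⟨ unsign (s n k) ⟩
  e ℤ.* (e ℤ.* s n k)         ≡⟨ cong (e ℤ.*_) (newtonSum-injective (suc n) (λ _ → 0) (signed s) (signed stirling₁)
                                   (λ x → trans (expand s isS x) (sym (expand stirling₁ stirling₁-isStirling₁ x))) k (s≤s k≤n)) ⟩
  e ℤ.* (e ℤ.* stirling₁ n k) ≡⟨ unsign (stirling₁ n k) ⟨
  stirling₁ n k               ∎
  where
  open ≡-Reasoning
  e : ℤ
  e = -1ℤ ℤ.^ (n ∸ k)
  unsign : ∀ z → z ≡ e ℤ.* (e ℤ.* z)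
  unsign z = trans (sym (ℤₚ.*-identityˡ z)) (trans (cong (ℤ._* z) (sym (-1^n*-1^n (n ∸ k)))) (ℤₚ.*-assoc e e z))
  signed : (ℕ → ℕ → ℤ) → ℕ → ℤ
  signed s k = -1ℤ ℤ.^ (n ∸ k) ℤ.* s n k
  expand : ∀ s → IsStirling₁ s → ∀ x → newtonSum (λ _ → 0) (suc n) (signed s) x ≡ falling x n
  expand s isS x = trans (ℤ∑.sum-cong-≗ {suc n} λ i → cong (signed s (toℕ i) ℤ.*_) (newton-0 x (toℕ i))) (sym (isS n x))

-- The triangular recurrence of both kinds of Stirling numbers, which differ in the factor `c`.

record Triangular (c : ℕ → ℕ → ℕ) (t : ℕ → ℕ → ℤ) : Set where
  field
    corner : t 0 0 ≡ 1ℤ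
    row    : ∀ k → t 0 (suc k) ≡ 0ℤ
    column : ∀ n → t (suc n) 0 ≡ 0ℤ
    step   : ∀ n k → t (suc n) (suc k) ≡ + c n k ℤ.* t n (suc k) ℤ.+ t n k

  above-diagonal : ∀ n k → n < k → t n k ≡ 0ℤ
  above-diagonal zero    (suc k) _         = row k
  above-diagonal (suc n) (suc k) (s≤s n<k) = trans (step n k)
    (cong₂ ℤ._+_ (trans (cong (+ c n k ℤ.*_) (above-diagonal n (suc k) (ℕₚ.m<n⇒m<1+n n<k))) (ℤₚ.*-zeroʳ (+ c n k)))
      (above-diagonal n k n<k))

  diagonal : ∀ n → t n n ≡ 1ℤ
  diagonal zero    = corner
  diagonal (suc n) = trans (step n n)
    (cong₂ ℤ._+_ (trans (cong (+ c n n ℤ.*_) (above-diagonal n (suc n) ℕₚ.≤-refl)) (ℤₚ.*-zeroʳ (+ c n n))) (diagonal n))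

stirling₂-triangular : Triangular (λ n k → suc k) stirling₂
stirling₂-triangular = record { corner = refl ; row = λ _ → refl ; column = λ _ → refl ; step = λ _ _ → refl }

stirling₁-triangular : Triangular (λ n k → n) stirling₁
stirling₁-triangular = record { corner = refl ; row = λ _ → refl ; column = column ; step = λ _ _ → refl }
  where
  column : ∀ n → stirling₁ (suc n) 0 ≡ 0ℤ
  column zero    = refl
  column (suc n) = trans (cong (+ suc n ℤ.*_) (column n)) (ℤₚ.*-zeroʳ (+ suc n))

-- Evaluation of the tuple sums by Stirling numbers.

module ClosedForm (L : ℕ) (d : Fin L → ℕ) {c t} (triangular : Triangular c t)
  (recurrence : TupleSum.Recurrence L d λ n m → c (n + suc m) m) where

  open TupleSum L d using (τ; τ-00)
  open Triangular triangular

  closed : ℕ → ℕ → ℤ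
  closed n m = -1ℤ ℤ.^ n ℤ.* (+ (m !) ℤ.* t (n + suc m) (suc m))

  -- The last hypothesis keeps the factor m in front of `τ`, so that it also makes sense for m = 0.
  -- With both values inserted, the recurrence of `τ` becomes that of `t` in row n + m + 2.
  τ-step : ∀ n m → n < L → τ (n + m) n 0 ≡ fromℤ (closed n m) →
    fromℕ m * τ (n + m) (suc n) 0 ≡ fromℤ (-1ℤ ℤ.^ suc n ℤ.* (+ (m !) ℤ.* t (n + suc m) m)) →
    τ (suc n + m) (suc n) 0 ≡ fromℤ (closed (suc n) m)
  τ-step n m n<L p q = begin
    τ (suc (n + m)) (suc n) 0
      ≡⟨ recurrence n m n<L ⟩
    fromℕ m * τ (n + m) (suc n) 0 ℚ.- fromℕ k * τ (n + m) n 0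
      ≡⟨ cong₂ (λ x y → x ℚ.- fromℕ k * y) q p ⟩
    fromℤ y ℚ.- fromℕ k * fromℤ (closed n m)
      ≡⟨ cong (λ x → fromℤ y ℚ.- x) (fromℤ-* (+ k) (closed n m)) ⟨
    fromℤ y ℚ.- fromℤ (+ k ℤ.* closed n m)
      ≡⟨ cong (λ z → fromℤ z ℚ.- fromℤ (+ k ℤ.* closed n m)) regroup ⟩
    fromℤ (closed (suc n) m ℤ.+ + k ℤ.* closed n m) ℚ.- fromℤ (+ k ℤ.* closed n m)
      ≡⟨ cong (ℚ._- fromℤ (+ k ℤ.* closed n m)) (fromℤ-+ (closed (suc n) m) (+ k ℤ.* closed n m)) ⟩
    fromℤ (closed (suc n) m) ℚ.+ fromℤ (+ k ℤ.* closed n m) ℚ.- fromℤ (+ k ℤ.* closed n m)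
      ≡⟨ cancel (fromℤ (closed (suc n) m)) (fromℤ (+ k ℤ.* closed n m)) ⟩
    fromℤ (closed (suc n) m) ∎
    where
    open ≡-Reasoning
    k : ℕ
    k = c (n + suc m) m
    y : ℤ
    y = -1ℤ ℤ.^ suc n ℤ.* (+ (m !) ℤ.* t (n + suc m) m)
    cancel : ∀ x y → x ℚ.+ y ℚ.- y ≡ x
    cancel = solve-∀ ring
    ringℤ : ∀ e f k u v → -1ℤ ℤ.* e ℤ.* (f ℤ.* v) ≡
      -1ℤ ℤ.* e ℤ.* (f ℤ.* (k ℤ.* u ℤ.+ v)) ℤ.+ k ℤ.* (e ℤ.* (f ℤ.* u))
    ringℤ = solveℤ
    regroup : y ≡ closed (suc n) m ℤ.+ + k ℤ.* closed n m
    regroup = trans (ringℤ (-1ℤ ℤ.^ n) (+ (m !)) (+ k) (t (n + suc m) (suc m)) (t (n + suc m) m))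
      (cong (λ z → -1ℤ ℤ.^ suc n ℤ.* (+ (m !) ℤ.* z) ℤ.+ + k ℤ.* closed n m) (sym (step (n + suc m) m)))

  -- Induction on n, and on m for fixed n: the value at (n + 1, m + 1) comes from those at (n, m +
  -- 1) and (n + 1, m). The base n = 0 is the diagonal of `t`.
  τ-closed : ∀ n m → n ≤ L → τ (n + m) n 0 ≡ fromℤ (closed n m)
  τ-closed zero m _ = trans (τ-00 m) (cong fromℤ (sym (trans (ℤₚ.*-identityˡ _)
    (trans (cong (+ (m !) ℤ.*_) (diagonal (suc m))) (ℤₚ.*-identityʳ (+ (m !)))))))
  -- For m = 0 the factor m annihilates the left side, and the right side is zero because column 0
  -- of `t` vanishes below the corner.
  τ-closed (suc n) zero n<L = τ-step n 0 n<L (τ-closed n 0 (ℕₚ.<⇒≤ n<L))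
    (trans (ℚₚ.*-zeroˡ (τ (n + 0) (suc n) 0)) (cong fromℤ (sym (trans
      (cong (λ z → -1ℤ ℤ.^ suc n ℤ.* (1ℤ ℤ.* z)) (trans (cong (λ x → t x 0) (ℕₚ.+-comm n 1)) (column n)))
      (ℤₚ.*-zeroʳ (-1ℤ ℤ.^ suc n))))))
  -- The factor m + 1 turns the m! in the closed form at (n + 1, m) into (m + 1)!.
  τ-closed (suc n) (suc m) n<L = τ-step n (suc m) n<L (τ-closed n (suc m) (ℕₚ.<⇒≤ n<L)) (begin
    fromℕ (suc m) * τ (n + suc m) (suc n) 0
      ≡⟨ cong (λ x → fromℕ (suc m) * τ x (suc n) 0) (ℕₚ.+-suc n m) ⟩
    fromℕ (suc m) * τ (suc n + m) (suc n) 0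
      ≡⟨ cong (fromℕ (suc m) *_) (τ-closed (suc n) m n<L) ⟩
    fromℕ (suc m) * fromℤ (closed (suc n) m)
      ≡⟨ fromℤ-* (+ suc m) (closed (suc n) m) ⟨
    fromℤ (+ suc m ℤ.* closed (suc n) m)
      ≡⟨ cong fromℤ (trans (ringℤ (+ suc m) (-1ℤ ℤ.^ suc n) (+ (m !)) (t (suc n + suc m) (suc m)))
           (cong₂ (λ f x → -1ℤ ℤ.^ suc n ℤ.* (f ℤ.* t x (suc m)))
             (sym (ℤₚ.pos-* (suc m) (m !))) (sym (ℕₚ.+-suc n (suc m))))) ⟩
    fromℤ (-1ℤ ℤ.^ suc n ℤ.* (+ (suc m !) ℤ.* t (n + suc (suc m)) (suc m))) ∎)
    where
    open ≡-Reasoning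
    ringℤ : ∀ s e f t → s ℤ.* (e ℤ.* (f ℤ.* t)) ≡ e ℤ.* (s ℤ.* f ℤ.* t)
    ringℤ = solveℤ

-- From tuple sums to the stated formulas.

from-τ : ∀ n m (d : Fin n → ℕ) (d≢0 : ∀ k → NonZero (denom d k)) z →
  TupleSum.τ n d (n + m) n 0 ≡ fromℤ (-1ℤ ℤ.^ n ℤ.* (+ (m !) ℤ.* z)) →
  z / 1 ≡ ((-1ℤ ℤ.^ n) / (m !)) {{ m !≢0 }}
    * (∑[ k ∈ tuples n ] ((-1ℤ ℤ.^ sum k ℤ.* + ((sum k + n + suc m ∸ 1) !)) / denom d k) {{ d≢0 k }})
from-τ n m d d≢0 z τ≡ = sym (begin
  (e / (m !)) {{ m !≢0 }} * sumOver (tuples n) summand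
    -- With length and bound both equal to n, `box` is the list that `tuples n` filters, so the sum
    -- is `τ` at weight n.
    ≡⟨ cong₂ _*_ (/-recip e (m !) {{ m !≢0 }}) (trans (sumOver-filter weight n box summand)
         (trans (sumOver-cong box termwise) τ≡)) ⟩
  fromℤ e * recip (m !) * fromℤ (e ℤ.* (+ (m !) ℤ.* z))
    ≡⟨ cong (fromℤ e * recip (m !) *_) (trans (fromℤ-* e (+ (m !) ℤ.* z))
         (cong (fromℤ e *_) (fromℤ-* (+ (m !)) z))) ⟩
  fromℤ e * recip (m !) * (fromℤ e * (fromℕ (m !) * fromℤ z))
    ≡⟨ collect (fromℤ e) (recip (m !)) (fromℕ (m !)) (fromℤ z) ⟩
  fromℤ e * fromℤ e * (fromℕ (m !) * recip (m !)) * fromℤ z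
    ≡⟨ cong₂ (λ x y → x * y * fromℤ z) (trans (sym (fromℤ-* e e)) (cong fromℤ (-1^n*-1^n n)))
         (n*recip[n] (m !) {{ m !≢0 }}) ⟩
  1ℚ * 1ℚ * fromℤ z
    ≡⟨ ℚₚ.*-identityˡ (fromℤ z) ⟩
  fromℤ z ∎)
  where
  open ≡-Reasoning
  open TupleSum n d using (box)
  e : ℤ
  e = -1ℤ ℤ.^ n
  collect : ∀ e r f z → e * r * (e * (f * z)) ≡ e * e * (f * r) * z
  collect = solve-∀ ring
  summand : Vec ℕ n → ℚ
  summand k = ((-1ℤ ℤ.^ sum k ℤ.* + ((sum k + n + suc m ∸ 1) !)) / denom d k) {{ d≢0 k }}
  index : ∀ k → sum k + n + suc m ∸ 1 ≡ sum k + (n + m)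
  -- The truncated subtraction is exact because `suc m` is positive.
  index k = trans (cong (_∸ 1) (ℕₚ.+-suc (sum k + n) m)) (ℕₚ.+-assoc (sum k) n m)
  termwise : ∀ k → δ (weight k) n * summand k ≡ δ (weight k) n * signed! (n + m) (sum k) * recip (denom d k)
  termwise k = trans (cong (δ (weight k) n *_) (trans (/-recip (-1ℤ ℤ.^ sum k ℤ.* + ((sum k + n + suc m ∸ 1) !)) (denom d k) {{ d≢0 k }})
      (cong (λ x → fromℤ (-1ℤ ℤ.^ sum k ℤ.* + (x !)) * recip (denom d k)) (index k))))
    (sym (ℚₚ.*-assoc (δ (weight k) n) (signed! (n + m) (sum k)) (recip (denom d k))))

theorem4p2 : (s S : ℕ → ℕ → ℤ) → IsStirling₁ s → IsStirling₂ S →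
    (m n : ℕ) .{{_ : NonZero m}} .{{_ : NonZero n}} →
    (S (n + m) m / 1
    ≡ ((-1ℤ ℤ.^ n) / ((m ∸ 1) !)) {{ (m ∸ 1) !≢0 }}
    * (∑[ k ∈ tuples n ]
    ((-1ℤ ℤ.^ sum k ℤ.* + ((sum k + n + m ∸ 1) !)) / powerDenom k) {{ powerDenom≢0 k }}))
    × (s (n + m) m / 1
    ≡ ((-1ℤ ℤ.^ n) / ((m ∸ 1) !)) {{ (m ∸ 1) !≢0 }}
    * (∑[ k ∈ tuples n ]
    ((-1ℤ ℤ.^ sum k ℤ.* + ((sum k + n + m ∸ 1) !)) / factorialDenom k) {{ factorialDenom≢0 k }}))
theorem4p2 s S isS₁ isS₂ (suc m) n@(suc n-1) =
  -- Since n is a successor, so is `n + suc m`, as the uniqueness lemmas require. `powerDenom` and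
  -- `factorialDenom` are instances of `denom` by definition.
  trans (cong (λ z → z / 1) (IsStirling₂-unique S isS₂ (n + suc m) (suc m) (ℕₚ.m≤n+m (suc m) n)))
    (from-τ n m (λ i → suc (suc (toℕ i))) powerDenom≢0 (stirling₂ (n + suc m) (suc m))
      (ClosedForm.τ-closed n (λ i → suc (suc (toℕ i))) stirling₂-triangular (Powers.powers-recurrence n) n m ℕₚ.≤-refl)) ,
  trans (cong (λ z → z / 1) (IsStirling₁-unique s isS₁ (n + suc m) (suc m) (ℕₚ.m≤n+m (suc m) n)))
    (from-τ n m (λ i → suc (suc (toℕ i)) !) factorialDenom≢0 (stirling₁ (n + suc m) (suc m))
      (ClosedForm.τ-closed n (λ i → suc (suc (toℕ i)) !) stirling₁-triangular (Factorials.factorials-recurrence n) n m ℕₚ.≤-refl))
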